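{- Fix a positive integer $M$ and the alphabet $\mathbf{x}=(x_1,\ldots,x_M)$. If $\lambda$ is a partition then \[ \mathcal{G}^{\mathbf{x}}_{\mathbf{t}}(t^\lambda)=\mathcal{S}^{\mathbf{x}}_{\mathbf{t}}\left(t^\lambda\prod_{i=1}^M(1-t_i)^{i-1}\right), \] i.e. $G_\lambda(\mathbf{x})$ equals the $\mathbb{Z}$-linear combination of (possibly fake) Schur functions $s_I(\mathbf{x})$ obtained by expanding the polynomial $t^\lambda\prod_{i=1}^M(1-t_i)^{i-1}$ into monomials $t^I$ and replacing each $t^I$ by $s_I(\mathbf{x})$.
   Context: For an integer sequence $I=(I_1,\ldots,I_p)$ the stable Grothendieck polynomial in variables $\boldsymbol\alpha=(\alpha_1,\ldots,\alpha_N)$, $\boldsymbol\beta=(\beta_1,\ldots,\beta_{N'})$ is $G_I(\boldsymbol\alpha;\boldsymbol\beta)=\mathrm{IR}_{\mathbf{z}=0,\infty}\big(\prod_{j=1}^p(1-z_j)^{I_j-j}\,\kappa_p\big)$, $\kappa_p=\big(\prod_{i=1}^p\frac{\prod_{b\in\boldsymbol\beta}(1-z_ib)}{\prod_{a\in\boldsymbol\alpha}(1-z_ia)}\frac{dz_i}{z_i(1-z_i)^{N-N'}}\big)\prod_{1\le i<j\le p}(1-z_j/z_i)$, where $\mathrm{IR}_{\mathbf{z}=0,\infty}$ means applying $\mathrm{Res}_{z_k=0}+\mathrm{Res}_{z_k=\infty}$ successively for $k=1,\ldots,p$. The single stable Grothendieck polynomial $G_I(\mathbf{x})$ is $G_I(\boldsymbol\alpha;\boldsymbol\beta)$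 with all $\beta_j=1$, written in variables $x_i=1-\alpha_i^{ -1}$; here $N=M$. For an ordered alphabet $\mathbf{t}$ and $I\in\mathbb{Z}^n$, $t^I=\prod_jt_j^{I_j}$, and $\mathcal{G}^{\mathbf{x}}_{\mathbf{t}}(t^I)=G_I(\mathbf{x})$. Let $h_r(\mathbf{x})$ be the complete homogeneous symmetric functions ($h_0=1$, $h_r=0$ for $r<0$); for any integer sequence $I=(I_1,\ldots,I_p)$ the (possibly fake) Schur function is $s_I(\mathbf{x})=\det\big(h_{I_i+j-i}(\mathbf{x})\big)_{1\le i,j\le p}$, and $\mathcal{S}^{\mathbf{x}}_{\mathbf{t}}(t^I)=s_I(\mathbf{x})$, both operations extended $\mathbb{Z}$-linearly. -}

module Defs where

open import Algebra.Bundles using (CommutativeRing)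
open import Data.Bool using (Bool; true; false; if_then_else_)
open import Data.Nat as ℕ using (ℕ; zero; suc; _∸_; _⊔_)
open import Data.Nat.Properties using (m≤n⊔m)
open import Data.Nat.Combinatorics using (_C_)
open import Data.Integer as ℤ using (ℤ; +_; -[1+_])
open import Data.Fin using (Fin; zero; suc; toℕ; punchIn; inject≤)
open import Data.List using (List; []; _∷_; _++_; map; foldr; concatMap; length; tabulate)
open import Data.List.Relation.Unary.All using (All)
open import Data.List.Relation.Unary.Linked using (Linked)
open import Data.Product using (_×_; _,_)
open import Level using (Level)

IsPartition : List ℕ → Set
IsPartition λs = Linked ℕ._≥_ λs × All (0 ℕ.<_) λs

nth : List ℕ → ℕ → ℕ
nth []       _       = 0
nth (a ∷ _)  zero    = a
nth (_ ∷ as) (suc i) = nth as i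

-- Laurent polynomials in n variables with coefficients in A:
-- finite formal sums  Σ c · t^I ,  I ∈ ℤ^n  (represented as lists of terms).

LPoly : {a : Level} → Set a → ℕ → Set a
LPoly A n = List (A × (Fin n → ℤ))

mulLP : {a : Level} {A : Set a} {n : ℕ} → (A → A → A) → LPoly A n → LPoly A n → LPoly A n
mulLP _·_ P Q =
  concatMap (λ { (c , I) → map (λ { (d , J) → (c · d , λ k → I k ℤ.+ J k) }) Q }) P

unitExp : {n : ℕ} → Fin n → Fin n → ℤ
unitExp k i = if toℕ k ℕ.≡ᵇ toℕ i then + 1 else + 0

zeroExp : {n : ℕ} → Fin n → ℤ
zeroExp _ = + 0

prodLP : {a : Level} {A : Set a} {n : ℕ} → (A → A → A) → A → (m : ℕ) → (Fin m → LPoly A n) → LPoly A n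
prodLP _·_ one zero    f = (one , zeroExp) ∷ []
prodLP _·_ one (suc m) f = mulLP _·_ (f zero) (prodLP _·_ one m (λ i → f (suc i)))

powLP : {a : Level} {A : Set a} {n : ℕ} → (A → A → A) → A → LPoly A n → ℕ → LPoly A n
powLP _·_ one P zero    = (one , zeroExp) ∷ []
powLP _·_ one P (suc k) = mulLP _·_ P (powLP _·_ one P k)

len : ℕ → List ℕ → ℕ
len M λs = length λs ⊔ M

padExp : (M : ℕ) (λs : List ℕ) → Fin (len M λs) → ℤ
padExp M λs k = + nth λs (toℕ k)

embed : (M : ℕ) (λs : List ℕ) → Fin M → Fin (len M λs)
embed M λs i = inject≤ i (m≤n⊔m (length λs) M)

rhsPoly : (M : ℕ) (λs : List ℕ) → LPoly ℤ (len M λs)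
rhsPoly M λs =
  mulLP ℤ._*_ ((+ 1 , padExp M λs) ∷ [])
    (prodLP ℤ._*_ (+ 1) M (λ i →
       powLP ℤ._*_ (+ 1)
         ((+ 1 , zeroExp) ∷ (ℤ.- (+ 1) , unitExp (embed M λs i)) ∷ [])
         (toℕ i)))

module WithRing {c ℓ} (R : CommutativeRing c ℓ) where
  open CommutativeRing R using (_+_; _*_; -_; 0#; 1#; _-_) renaming (Carrier to A)

  nat : ℕ → A
  nat zero    = 0#
  nat (suc n) = 1# + nat n

  int : ℤ → A
  int (+ n)    = nat n
  int -[1+ n ] = - nat (suc n)

  pow : A → ℕ → A
  pow a zero    = 1#
  pow a (suc n) = a * pow a n

  sumℕ : ℕ → (ℕ → A) → A
  sumℕ zero    f = 0#
  sumℕ (suc n) f = f 0 + sumℕ n (λ i → f (suc i))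

  sumFin : (n : ℕ) → (Fin n → A) → A
  sumFin zero    f = 0#
  sumFin (suc n) f = f zero + sumFin n (λ i → f (suc i))

  prodFin : (n : ℕ) → (Fin n → A) → A
  prodFin zero    f = 1#
  prodFin (suc n) f = f zero * prodFin n (λ i → f (suc i))

  -- Complete homogeneous symmetric polynomials h_r(x_1..x_M), h_r = 0 for r < 0.

  hN : (M : ℕ) → (Fin M → A) → ℕ → A
  hN zero    x zero    = 1#
  hN zero    x (suc r) = 0#
  hN (suc M) x r = sumℕ (suc r) (λ k → pow (x zero) k * hN M (λ i → x (suc i)) (r ∸ k))

  h : {M : ℕ} → (Fin M → A) → ℤ → A
  h {M} x (+ r)    = hN M x r
  h     x -[1+ _ ] = 0#

  det : (n : ℕ) → (Fin n → Fin n → A) → A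
  det zero    B = 1#
  det (suc n) B =
    sumFin (suc n) (λ j → pow (- 1#) (toℕ j) * B zero j
                          * det n (λ r s → B (suc r) (punchIn j s)))

  schur : {M : ℕ} → (Fin M → A) → (p : ℕ) → (Fin p → ℤ) → A
  schur x p I = det p (λ i j → h x (I i ℤ.+ (+ toℕ j) ℤ.- (+ toℕ i)))

  𝒮 : {M : ℕ} → (Fin M → A) → {n : ℕ} → LPoly ℤ n → A
  𝒮 x {n} P = foldr (λ { (c , I) acc → int c * schur x n I + acc }) 0# P

  -- Formal Laurent series  z^shift · Σ_{n≥0} coef n · z^n  in a local coordinate.

  record Laurent : Set c where
    field
      shift : ℤ
      coef  : ℕ → A
  open Laurent

  mulL : Laurent → Laurent → Laurent
  mulL f g = record { shift = shift f ℤ.+ shift g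
                    ; coef  = λ n → sumℕ (suc n) (λ i → coef f i * coef g (n ∸ i)) }

  monoL : ℤ → Laurent
  monoL m = record { shift = m ; coef = λ { zero → 1# ; (suc _) → 0# } }

  coeffL : Laurent → ℤ → A
  coeffL f k with k ℤ.- shift f
  ... | + n      = coef f n
  ... | -[1+ _ ] = 0#

  -- factors (1 - c z)^e of the integrand:
  --   posF c k        = (1 - c z)^k
  --   negF c cinv k   = (1 - c z)^{-(k+1)},  where cinv is the inverse of c
  data Factor : Set c where
    posF : A → ℕ → Factor
    negF : A → A → ℕ → Factor

  oneMinusZ^ : ℤ → Factor
  oneMinusZ^ (+ k)    = posF 1# k
  oneMinusZ^ -[1+ k ] = negF 1# 1# k

  at0 : Factor → Laurent
  at0 (posF c k)   = record { shift = + 0 ; coef = λ n → nat (k C n) * pow (- c) n }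
  at0 (negF c _ k) = record { shift = + 0 ; coef = λ n → nat ((k ℕ.+ n) C n) * pow c n }

  -- Laurent expansion at z = ∞ (coordinate w = 1/z):
  --   (1 - c/w)^k       = w^{-k} Σ_n (k C n) (-c)^{k-n} w^n
  --   (1 - c/w)^{-(k+1)} = w^{k+1} (-c⁻¹)^{k+1} Σ_n ((k+n) C n) c^{-n} w^n
  atInf : Factor → Laurent
  atInf (posF c k) =
    record { shift = ℤ.- (+ k) ; coef = λ n → nat (k C n) * pow (- c) (k ∸ n) }
  atInf (negF c cinv k) =
    record { shift = + suc k
           ; coef = λ n → pow (- cinv) (suc k) * (nat ((k ℕ.+ n) C n) * pow cinv n) }

  -- A one-variable rational differential form  z^m · ∏ factors · dz.
  record OneForm : Set c where
    constructor form
    field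
      mono    : ℤ
      factors : List Factor

  res0 : OneForm → A
  res0 (form m fs) = coeffL (foldr mulL (monoL m) (map at0 fs)) (ℤ.- (+ 1))

  resInf : OneForm → A
  resInf (form m fs) = - coeffL (foldr mulL (monoL (ℤ.- m)) (map atInf fs)) (+ 1)

  IR1 : OneForm → A
  IR1 ω = res0 ω + resInf ω

  shiftForm : ℤ → OneForm → OneForm
  shiftForm k (form m fs) = form (k ℤ.+ m) fs

  -- IR_{z=0,∞} of  P(z) · ∏_j ω_j(z_j)  with P a Laurent polynomial in z_1..z_p:
  -- applying Res_{z_k=0}+Res_{z_k=∞} successively for k = 1..p (each step is linear,
  -- and the factors not involving z_k are constants for that step).
  IR : (p : ℕ) → LPoly A p → (Fin p → OneForm) → A
  IR p P ω = foldr (λ { (a , m) acc →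
                 a * prodFin p (λ j → IR1 (shiftForm (m j) (ω j))) + acc }) 0# P

  crossTerm : (p : ℕ) → LPoly A p
  crossTerm p = prodLP _*_ 1# p (λ i → prodLP _*_ 1# p (λ j →
    if toℕ i ℕ.<ᵇ toℕ j
    then (1# , zeroExp) ∷ (- 1# , (λ k → unitExp j k ℤ.- unitExp i k)) ∷ []
    else (1# , zeroExp) ∷ []))

  -- Stable Grothendieck polynomial G_I(α; β) via the residue formula.
  -- α : N variables, αinv their inverses; β : N' variables.
  -- ω_j = (1-z)^{I_j - j} ∏_b (1 - z b) / ∏_a (1 - z a) · dz / (z (1-z)^{N-N'})
  G : (p : ℕ) → (Fin p → ℤ) → (N : ℕ) → (Fin N → A) → (Fin N → A)
      → (N' : ℕ) → (Fin N' → A) → A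
  G p I N α αinv N' β = IR p (crossTerm p) ω
    where
      ω : Fin p → OneForm
      ω j = form (ℤ.- (+ 1))
              (oneMinusZ^ (I j ℤ.- (+ suc (toℕ j)))
               ∷ (tabulate (λ b → posF (β b) 1)
                 ++ tabulate (λ a → negF (α a) (αinv a) 0)
                 ++ oneMinusZ^ (ℤ.- ((+ N) ℤ.- (+ N'))) ∷ []))

  -- Single stable Grothendieck polynomial G_I(x): all β_j = 1 with N' = N = M,
  -- and α given with x_i = 1 - α_i⁻¹, i.e. α_i⁻¹ = 1 - x_i.
  Gsingle : {M : ℕ} → (x α : Fin M → A) → (p : ℕ) → (Fin p → ℤ) → A
  Gsingle {M} x α p I = G p I M α (λ i → 1# - x i) M (λ _ → 1#)

  𝒢mono : {M : ℕ} → (x α : Fin M → A) → {n : ℕ} → (Fin n → ℤ) → A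
  𝒢mono x α {n} I = Gsingle x α n I

{-# OPTIONS --safe #-}
-- Put u = 1 - z. Expanding the product of the factors 1 - z_j/z_i as the Vandermonde
-- determinant det (z_i^{i-j}) makes the residue formula a determinant of one-variable
-- residues, G_λ = det ψ(z_i^{i-j-1} u^{λ_i-i}) with ψ(f) the residue at 0 and ∞ of
-- f ∏_a (1-z)/(1-α_a z) dz.  Since (1-z)/(1-α_a z) = (1-x_a)/(1-x_a/u), one has
-- ψ(u^e) = P h_{e+1} with P = ∏ (1-x_a), while ψ kills the multiples z^m u^e ∏ (u-x_a)
-- with e ≥ 0.  Hence column operations may be done modulo a monic polynomial Q in u of
-- degree p with Q(1) = P: there the columns z^{-j} and z^{-(p-1)} u^j have the same
-- determinant (two shears), and multiplying all p columns by z multiplies it by P.  After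
-- p multiplications the columns are z u^j, so P^p G_λ is P^p times the determinant of the
-- Δ^{i-1} h at λ_i + j - i, where ΔF(e) = F(e) - F(e+1).  The latter is the
-- Schur side, by linearity in the rows; if λ has more than M parts both determinants vanish.
module Submission where

open import Defs
open import Algebra.Bundles using (CommutativeRing)
open import Data.Bool using (true; false; if_then_else_)
open import Data.Fin as Fin using (Fin; zero; suc; toℕ; inject₁; punchIn; punchOut)
import Data.Fin.Properties as Finₚ
open import Data.Integer as ℤ using (ℤ; +_; -[1+_])
import Data.Integer.Properties as ℤₚ
import Data.Integer.Solver as ℤ-Solver
open import Data.List using (List; []; _∷_; _++_; map; foldr; tabulate; length)
open import Data.List.Relation.Unary.All using (All; []; _∷_)
open import Data.Maybe using (Maybe; just; nothing)
open import Data.Nat as ℕ using (ℕ; zero; suc; s≤s; z≤n; _∸_; _<_)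
import Data.Nat.Properties as ℕₚ
open import Data.Product using (Σ; _,_)
open import Data.Sum using (_⊎_; inj₁; inj₂)
open import Function using (_∘_)
open import Level using (_⊔_)
open import Relation.Binary.PropositionalEquality as ≡ using (_≡_; _≢_)
open import Relation.Nullary using (yes; no; contradiction)

open ℤ-Solver.+-*-Solver using ()
  renaming (solve to ℤ-solve; _:=_ to _⊜_; _:+_ to _⊕_; _:-_ to _⊖_; :-_ to ⊝_; con to ⊚)

-- The obstacle is the negative powers of z in the columns. Modulo Q the element z is invertible
-- since Q(1) is a unit; rather than computing an inverse, the proof multiplies all columns by z
-- until no negative power is left and then cancels P^p, whose inverse is the p-th power of the
-- product of the α_a. The concrete choice is Q = u^{p-M} ∏ (u - x_a), which asks for p ≥ M.
-- Multiplying u^{λ_i-i} by Q removes every denominator and leaves P u^{λ_i-i+p}, an honest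
-- polynomial because i ≤ p and λ_i ≥ 0. The exponent p of P appears twice for different reasons:
-- once per multiplication by z, and once per row from ψ(u^e) = P h_{e+1}. For p > M the two sides
-- are not equal entry by entry: the product on the Schur side stops at i = M, so the later rows
-- carry no differences. This is why that case is settled by showing that both determinants vanish.

-- Integer coefficients in a commutative ring, and a ring solver using them.

module IntegerSolver {c ℓ} (R : CommutativeRing c ℓ) where
  open CommutativeRing R
  open import Algebra.Properties.Ring ring using (-‿distribˡ-*; -‿distribʳ-*; -0#≈0#; -‿involutive; -‿+-comm)
  open import Algebra.Properties.Semiring.Mult.TCOptimised semiring
    using (_×_; ×-homo-+; ×1-homo-*; 1+×)
  open import Algebra.Solver.Ring.AlmostCommutativeRing
    using (fromCommutativeRing; _-Raw-AlmostCommutative⟶_)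
  open import Relation.Binary.Reasoning.Setoid setoid
  open WithRing R using (nat; int)

  -- With the optimised multiple, `ι (+ 1)` is definitionally `1#`, so solver constants match the
  -- `1#` and `- 1#` of the goals; `int (+ 1)` would be `1# + 0#`.
  ι : ℤ → Carrier
  ι (+ n)    = n × 1#
  ι -[1+ n ] = - (suc n × 1#)

  ι-neg : ∀ i → ι (ℤ.- i) ≈ - ι i
  ι-neg (+ zero)  = sym -0#≈0#
  ι-neg (+ suc n) = refl
  ι-neg -[1+ n ]  = sym (-‿involutive _)

  ι-⊖ : ∀ m n → ι (m ℤ.⊖ n) ≈ m × 1# + - (n × 1#)
  ι-⊖ m       zero    = begin
    ι (m ℤ.⊖ 0)        ≡⟨ ≡.cong ι (ℤₚ.⊖-≥ {m} ℕ.z≤n) ⟩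
    m × 1#             ≈⟨ +-identityʳ _ ⟨
    m × 1# + 0#        ≈⟨ +-congˡ -0#≈0# ⟨
    m × 1# + - 0#      ∎
  ι-⊖ zero    (suc n) = sym (+-identityˡ _)
  ι-⊖ (suc m) (suc n) = begin
    ι (suc m ℤ.⊖ suc n)                    ≡⟨ ≡.cong ι (ℤₚ.[1+m]⊖[1+n]≡m⊖n m n) ⟩
    ι (m ℤ.⊖ n)                            ≈⟨ ι-⊖ m n ⟩
    m × 1# + - (n × 1#)                    ≈⟨ +-congˡ (+-identityˡ _) ⟨
    m × 1# + (0# + - (n × 1#))             ≈⟨ +-congˡ (+-congʳ (-‿inverseʳ 1#)) ⟨
    m × 1# + (1# + - 1# + - (n × 1#))      ≈⟨ +-congˡ (+-assoc _ _ _) ⟩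
    m × 1# + (1# + (- 1# + - (n × 1#)))    ≈⟨ +-assoc _ _ _ ⟨
    m × 1# + 1# + (- 1# + - (n × 1#))      ≈⟨ +-cong (+-comm _ _) (-‿+-comm _ _) ⟩
    1# + m × 1# + - (1# + n × 1#)          ≈⟨ +-cong (1+× m 1#) (-‿cong (1+× n 1#)) ⟨
    suc m × 1# + - (suc n × 1#)            ∎

  ι-+ : ∀ i j → ι (i ℤ.+ j) ≈ ι i + ι j
  ι-+ (+ m)    (+ n)    = ×-homo-+ 1# m n
  ι-+ (+ m)    -[1+ n ] = ι-⊖ m (suc n)
  ι-+ -[1+ m ] (+ n)    = trans (ι-⊖ n (suc m)) (+-comm _ _)
  ι-+ -[1+ m ] -[1+ n ] = begin
    - (suc (suc (m ℕ.+ n)) × 1#)     ≡⟨ ≡.cong (λ k → - (k × 1#)) (≡.cong suc (≡.sym (ℕₚ.+-suc m n))) ⟩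
    - ((suc m ℕ.+ suc n) × 1#)       ≈⟨ -‿cong (×-homo-+ 1# (suc m) (suc n)) ⟩
    - (suc m × 1# + suc n × 1#)      ≈⟨ -‿+-comm _ _ ⟨
    - (suc m × 1#) + - (suc n × 1#)  ∎
    where import Data.Nat.Properties as ℕₚ

  ι-*-pos : ∀ m j → ι (+ m ℤ.* j) ≈ ι (+ m) * ι j
  ι-*-pos m (+ n) = begin
    ι (+ m ℤ.* + n)     ≡⟨ ≡.cong ι (ℤₚ.pos-* m n) ⟨
    (m ℕ.* n) × 1#      ≈⟨ ×1-homo-* m n ⟩
    (m × 1#) * (n × 1#) ∎
  ι-*-pos m -[1+ n ] = begin
    ι (+ m ℤ.* -[1+ n ])         ≡⟨ ≡.cong ι (ℤₚ.neg-distribʳ-* (+ m) (+ suc n)) ⟨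
    ι (ℤ.- (+ m ℤ.* + suc n))    ≈⟨ ι-neg (+ m ℤ.* + suc n) ⟩
    - ι (+ m ℤ.* + suc n)        ≈⟨ -‿cong (ι-*-pos m (+ suc n)) ⟩
    - (ι (+ m) * ι (+ suc n))    ≈⟨ -‿distribʳ-* _ _ ⟩
    ι (+ m) * ι -[1+ n ]         ∎

  ι-* : ∀ i j → ι (i ℤ.* j) ≈ ι i * ι j
  ι-* (+ m)    j = ι-*-pos m j
  ι-* -[1+ m ] j = begin
    ι (-[1+ m ] ℤ.* j)           ≡⟨ ≡.cong ι (ℤₚ.neg-distribˡ-* (+ suc m) j) ⟨
    ι (ℤ.- (+ suc m ℤ.* j))      ≈⟨ ι-neg (+ suc m ℤ.* j) ⟩
    - ι (+ suc m ℤ.* j)          ≈⟨ -‿cong (ι-*-pos (suc m) j) ⟩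
    - (ι (+ suc m) * ι j)        ≈⟨ -‿distribˡ-* _ _ ⟩
    ι -[1+ m ] * ι j             ∎

  private
    homomorphism : ℤ.+-*-rawRing -Raw-AlmostCommutative⟶ fromCommutativeRing R
    homomorphism = record
      { ⟦_⟧ = ι ; +-homo = ι-+ ; *-homo = ι-* ; -‿homo = ι-neg ; 0-homo = refl ; 1-homo = refl }

    ι-≟ : ∀ i j → Maybe (ι i ≈ ι j)
    ι-≟ i j with i ℤ.≟ j
    ... | yes i≡j = just (reflexive (≡.cong ι i≡j))
    ... | no  _   = nothing

  open import Algebra.Solver.Ring ℤ.+-*-rawRing (fromCommutativeRing R) homomorphism ι-≟ public
    using (solve; con; _:+_; _:*_; _:-_; :-_; _:=_)

  nat≈× : ∀ n → nat n ≈ n × 1#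
  nat≈× zero    = refl
  nat≈× (suc n) = trans (+-congˡ (nat≈× n)) (sym (1+× n 1#))

  int≈ι : ∀ i → int i ≈ ι i
  int≈ι (+ n)    = nat≈× n
  int≈ι -[1+ n ] = -‿cong (nat≈× (suc n))

  nat-+ : ∀ m n → nat (m ℕ.+ n) ≈ nat m + nat n
  nat-+ zero    n = sym (+-identityˡ _)
  nat-+ (suc m) n = trans (+-congˡ (nat-+ m n)) (sym (+-assoc _ _ _))

  int-* : ∀ i j → int (i ℤ.* j) ≈ int i * int j
  int-* i j = trans (int≈ι (i ℤ.* j)) (trans (ι-* i j) (sym (*-cong (int≈ι i) (int≈ι j))))

-- Determinants by row expansion, column operations and changes of basis.

module Determinants {c ℓ} (R : CommutativeRing c ℓ) where
  open CommutativeRing R hiding (zero)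
  open WithRing R using (sumFin; prodFin; det; pow)
  open IntegerSolver R
  open import Relation.Binary.Reasoning.Setoid setoid
  open import Data.Product using (_×_)

  Matrix : ℕ → Set c
  Matrix n = Fin n → Fin n → Carrier

  sumFin-cong : ∀ {n} {f g : Fin n → Carrier} → (∀ i → f i ≈ g i) → sumFin n f ≈ sumFin n g
  sumFin-cong {zero}  f≈g = refl
  sumFin-cong {suc n} f≈g = +-cong (f≈g zero) (sumFin-cong (f≈g ∘ suc))

  sumFin-zero : ∀ {n} {f : Fin n → Carrier} → (∀ i → f i ≈ 0#) → sumFin n f ≈ 0#
  sumFin-zero {zero}  f≈0 = refl
  sumFin-zero {suc n} f≈0 = trans (+-cong (f≈0 zero) (sumFin-zero (f≈0 ∘ suc))) (+-identityʳ 0#)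

  sumFin-linear : ∀ {n} a b {f g h : Fin n → Carrier} → (∀ i → f i ≈ a * g i + b * h i) →
                  sumFin n f ≈ a * sumFin n g + b * sumFin n h
  sumFin-linear {zero}  a b f≈ = solve 2 (λ a b → con (+ 0) := a :* con (+ 0) :+ b :* con (+ 0)) refl a b
  sumFin-linear {suc n} a b f≈ = trans (+-cong (f≈ zero) (sumFin-linear a b (f≈ ∘ suc)))
    (solve 6 (λ a b g h G H → a :* g :+ b :* h :+ (a :* G :+ b :* H) := a :* (g :+ G) :+ b :* (h :+ H))
           refl a b _ _ _ _)

  prodFin-cong : ∀ {n} {f g : Fin n → Carrier} → (∀ i → f i ≈ g i) → prodFin n f ≈ prodFin n g
  prodFin-cong {zero}  f≈g = refl
  prodFin-cong {suc n} f≈g = *-cong (f≈g zero) (prodFin-cong (f≈g ∘ suc))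

  det-cong : ∀ {n} {A B : Matrix n} → (∀ i j → A i j ≈ B i j) → det n A ≈ det n B
  det-cong {zero}  A≈B = refl
  det-cong {suc n} A≈B = sumFin-cong λ j →
    *-cong (*-congˡ {pow (- 1#) (toℕ j)} (A≈B zero j)) (det-cong λ r s → A≈B (suc r) (punchIn j s))

  det-row-linear : ∀ {n} (k : Fin n) a b {A B C : Matrix n} →
    (∀ j → A k j ≈ a * B k j + b * C k j) →
    (∀ i j → i ≢ k → A i j ≈ B i j) → (∀ i j → i ≢ k → A i j ≈ C i j) →
    det n A ≈ a * det n B + b * det n C
  det-row-linear {suc n} zero a b {A} {B} {C} at-k A≈B A≈C = sumFin-linear a b λ j → begin
    pow (- 1#) (toℕ j) * A zero j * minor A j                  ≈⟨ *-congʳ (*-congˡ (at-k j)) ⟩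
    pow (- 1#) (toℕ j) * (a * B zero j + b * C zero j) * minor A j
      ≈⟨ solve 6 (λ p a x b y m → p :* (a :* x :+ b :* y) :* m := a :* (p :* x :* m) :+ b :* (p :* y :* m))
                 refl _ _ _ _ _ _ ⟩
    a * (pow (- 1#) (toℕ j) * B zero j * minor A j) + b * (pow (- 1#) (toℕ j) * C zero j * minor A j)
      ≈⟨ +-cong (*-congˡ (*-congˡ (det-cong λ r s → A≈B (suc r) (punchIn j s) λ ())))
                (*-congˡ (*-congˡ (det-cong λ r s → A≈C (suc r) (punchIn j s) λ ()))) ⟩
    a * (pow (- 1#) (toℕ j) * B zero j * minor B j) + b * (pow (- 1#) (toℕ j) * C zero j * minor C j) ∎
    where
    minor : Matrix (suc n) → Fin (suc n) → Carrier
    minor X j = det n (λ r s → X (suc r) (punchIn j s))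
  det-row-linear {suc n} (suc k) a b {A} {B} {C} at-k A≈B A≈C = sumFin-linear a b λ j → begin
    pow (- 1#) (toℕ j) * A zero j * minor A j
      ≈⟨ *-congˡ (det-row-linear k a b (λ s → at-k (punchIn j s))
           (λ i s i≢k → A≈B (suc i) (punchIn j s) (i≢k ∘ Finₚ.suc-injective))
           (λ i s i≢k → A≈C (suc i) (punchIn j s) (i≢k ∘ Finₚ.suc-injective))) ⟩
    pow (- 1#) (toℕ j) * A zero j * (a * minor B j + b * minor C j)
      ≈⟨ solve 6 (λ p x a m b m′ → p :* x :* (a :* m :+ b :* m′) := a :* (p :* x :* m) :+ b :* (p :* x :* m′))
                 refl _ _ _ _ _ _ ⟩
    a * (pow (- 1#) (toℕ j) * A zero j * minor B j) + b * (pow (- 1#) (toℕ j) * A zero j * minor C j)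
      ≈⟨ +-cong (*-congˡ (*-congʳ (*-congˡ (A≈B zero j λ ())))) (*-congˡ (*-congʳ (*-congˡ (A≈C zero j λ ())))) ⟩
    a * (pow (- 1#) (toℕ j) * B zero j * minor B j) + b * (pow (- 1#) (toℕ j) * C zero j * minor C j) ∎
    where
    minor : Matrix (suc n) → Fin (suc n) → Carrier
    minor X j = det n (λ r s → X (suc r) (punchIn j s))

  -- In the expansion along row 0, the term of column `k` carries the combination in its entry while
  -- its minor does not see column `k`. Every other term carries it in its minor, where column `k`
  -- sits at the `punchOut` position.
  det-col-linear : ∀ {n} (k : Fin n) a b {A B C : Matrix n} →
    (∀ i → A i k ≈ a * B i k + b * C i k) →
    (∀ i j → j ≢ k → A i j ≈ B i j) → (∀ i j → j ≢ k → A i j ≈ C i j) →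
    det n A ≈ a * det n B + b * det n C
  det-col-linear {suc n} k a b {A} {B} {C} at-k A≈B A≈C = sumFin-linear a b term
    where
    minor : Matrix (suc n) → Fin (suc n) → Carrier
    minor X j = det n (λ r s → X (suc r) (punchIn j s))

    term : ∀ j → pow (- 1#) (toℕ j) * A zero j * minor A j
               ≈ a * (pow (- 1#) (toℕ j) * B zero j * minor B j) + b * (pow (- 1#) (toℕ j) * C zero j * minor C j)
    term j with j Fin.≟ k
    ... | yes ≡.refl = begin
      pow (- 1#) (toℕ j) * A zero j * minor A j                  ≈⟨ *-congʳ (*-congˡ (at-k zero)) ⟩
      pow (- 1#) (toℕ j) * (a * B zero j + b * C zero j) * minor A j
        ≈⟨ solve 6 (λ p a x b y m → p :* (a :* x :+ b :* y) :* m := a :* (p :* x :* m) :+ b :* (p :* y :* m))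
                   refl _ _ _ _ _ _ ⟩
      a * (pow (- 1#) (toℕ j) * B zero j * minor A j) + b * (pow (- 1#) (toℕ j) * C zero j * minor A j)
        ≈⟨ +-cong (*-congˡ (*-congˡ (det-cong λ r s → A≈B (suc r) (punchIn j s) (Finₚ.punchInᵢ≢i j s))))
                  (*-congˡ (*-congˡ (det-cong λ r s → A≈C (suc r) (punchIn j s) (Finₚ.punchInᵢ≢i j s)))) ⟩
      a * (pow (- 1#) (toℕ j) * B zero j * minor B j) + b * (pow (- 1#) (toℕ j) * C zero j * minor C j) ∎
    ... | no j≢k = begin
      pow (- 1#) (toℕ j) * A zero j * minor A j
        ≈⟨ *-congˡ (det-col-linear (punchOut j≢k) a b
             (λ i → ≡.subst (λ t → A (suc i) t ≈ a * B (suc i) t + b * C (suc i) t)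
                            (≡.sym (Finₚ.punchIn-punchOut j≢k)) (at-k (suc i)))
             (λ i s s≢ → A≈B (suc i) (punchIn j s) (avoid s≢))
             (λ i s s≢ → A≈C (suc i) (punchIn j s) (avoid s≢))) ⟩
      pow (- 1#) (toℕ j) * A zero j * (a * minor B j + b * minor C j)
        ≈⟨ solve 6 (λ p x a m b m′ → p :* x :* (a :* m :+ b :* m′) := a :* (p :* x :* m) :+ b :* (p :* x :* m′))
                   refl _ _ _ _ _ _ ⟩
      a * (pow (- 1#) (toℕ j) * A zero j * minor B j) + b * (pow (- 1#) (toℕ j) * A zero j * minor C j)
        ≈⟨ +-cong (*-congˡ (*-congʳ (*-congˡ (A≈B zero j j≢k)))) (*-congˡ (*-congʳ (*-congˡ (A≈C zero j j≢k)))) ⟩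
      a * (pow (- 1#) (toℕ j) * B zero j * minor B j) + b * (pow (- 1#) (toℕ j) * C zero j * minor C j) ∎
      where
      avoid : ∀ {s} → s ≢ punchOut j≢k → punchIn j s ≢ k
      avoid {s} s≢ eq = s≢ (Finₚ.punchIn-injective j s _ (≡.trans eq (≡.sym (Finₚ.punchIn-punchOut j≢k))))

  det-zero-col : ∀ {n} (k : Fin n) (A : Matrix n) → (∀ i → A i k ≈ 0#) → det n A ≈ 0#
  det-zero-col k A A≈0 = trans
    (det-col-linear k 0# 0# {B = A} {C = A}
      (λ i → trans (A≈0 i) (solve 1 (λ x → con (+ 0) := con (+ 0) :* x :+ con (+ 0) :* x) refl _))
      (λ _ _ _ → refl) (λ _ _ _ → refl))
    (solve 1 (λ x → con (+ 0) :* x :+ con (+ 0) :* x := con (+ 0)) refl _)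

  det-scale-rows : ∀ {n} (y : Fin n → Carrier) (A : Matrix n) →
    det n (λ i j → y i * A i j) ≈ prodFin n y * det n A
  det-scale-rows {zero}  y A = sym (*-identityˡ _)
  det-scale-rows {suc n} y A = trans
    (sumFin-linear (prodFin (suc n) y) 0# λ j → trans (*-congˡ (det-scale-rows (y ∘ suc) (λ r s → A (suc r) (punchIn j s))))
      (solve 5 (λ p x a Y d → p :* (x :* a) :* (Y :* d) := x :* Y :* (p :* a :* d) :+ con (+ 0) :* con (+ 0))
               refl (pow (- 1#) (toℕ j)) (y zero) (A zero j) (prodFin n (y ∘ suc)) _))
    (trans (+-congˡ (zeroˡ _)) (+-identityʳ _))

  sumFin-adjacent : ∀ {n} (k : Fin n) {f : Fin (suc n) → Carrier} →
    (∀ j → j ≢ inject₁ k → j ≢ suc k → f j ≈ 0#) → f (inject₁ k) + f (suc k) ≈ 0# → sumFin (suc n) f ≈ 0#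
  sumFin-adjacent {suc n} zero {f} off pair = begin
    f zero + (f (suc zero) + sumFin n (λ i → f (suc (suc i))))  ≈⟨ +-assoc _ _ _ ⟨
    f zero + f (suc zero) + sumFin n (λ i → f (suc (suc i)))
      ≈⟨ +-cong pair (sumFin-zero λ i → off (suc (suc i)) (λ ()) (λ ())) ⟩
    0# + 0#                                                     ≈⟨ +-identityʳ 0# ⟩
    0#                                                          ∎
  sumFin-adjacent (suc k) off pair = trans
    (+-cong (off zero (λ ()) (λ ()))
      (sumFin-adjacent k (λ j j≢ j≢′ → off (suc j) (j≢ ∘ Finₚ.suc-injective) (j≢′ ∘ Finₚ.suc-injective)) pair))
    (+-identityʳ 0#)

  -- Matching on `retains` also exposes the size of the minor as a successor, as the induction on
  -- smaller determinants requires.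
  data RetainsAdjacent : ∀ {n} → Fin (suc n) → Fin n → Set where
    retains : ∀ {m} {j : Fin (suc (suc m))} {k} (k′ : Fin m) →
              punchIn j (inject₁ k′) ≡ inject₁ k → punchIn j (suc k′) ≡ suc k → RetainsAdjacent j k

  punchIn-adjacent : ∀ {n} (j : Fin (suc n)) (k : Fin n) → j ≢ inject₁ k → j ≢ suc k → RetainsAdjacent j k
  punchIn-adjacent zero          zero    j≢ _ = contradiction ≡.refl j≢
  punchIn-adjacent zero          (suc k) _ _  = retains k ≡.refl ≡.refl
  punchIn-adjacent (suc zero)    zero    _ j≢ = contradiction ≡.refl j≢
  punchIn-adjacent {suc (suc n)} (suc (suc j)) zero _ _ = retains zero ≡.refl ≡.refl
  punchIn-adjacent (suc j)       (suc k) j≢ j≢′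
    with punchIn-adjacent j k (j≢ ∘ ≡.cong suc) (j≢′ ∘ ≡.cong suc)
  ... | retains k′ p q = retains (suc k′) (≡.cong suc p) (≡.cong suc q)

  punchIn-inject₁-suc : ∀ {n} (k s : Fin n) →
    punchIn (inject₁ k) s ≡ punchIn (suc k) s ⊎ (punchIn (inject₁ k) s ≡ suc k × punchIn (suc k) s ≡ inject₁ k)
  punchIn-inject₁-suc zero    zero    = inj₂ (≡.refl , ≡.refl)
  punchIn-inject₁-suc zero    (suc s) = inj₁ ≡.refl
  punchIn-inject₁-suc (suc k) zero    = inj₁ ≡.refl
  punchIn-inject₁-suc (suc k) (suc s) with punchIn-inject₁-suc k s
  ... | inj₁ p       = inj₁ (≡.cong suc p)
  ... | inj₂ (p , q) = inj₂ (≡.cong suc p , ≡.cong suc q)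

  pow-inject₁ : ∀ {n} a (k : Fin n) → pow a (toℕ (inject₁ k)) ≈ pow a (toℕ k)
  pow-inject₁ a k = reflexive (≡.cong (pow a) (Finₚ.toℕ-inject₁ k))

  -- Expand along row 0. Deleting any other column leaves the two adjacent in the minor, so that
  -- term vanishes by induction; the two remaining terms have equal minors and consecutive signs.
  -- Neighbours suffice for every column operation below, so permutations never enter.
  det-equal-adjacent-cols : ∀ {n} (k : Fin n) (A : Matrix (suc n)) →
    (∀ i → A i (inject₁ k) ≈ A i (suc k)) → det (suc n) A ≈ 0#
  det-equal-adjacent-cols {n} k A eq = sumFin-adjacent k off pair
    where
    off : ∀ j → j ≢ inject₁ k → j ≢ suc k →
          pow (- 1#) (toℕ j) * A zero j * det n (λ r s → A (suc r) (punchIn j s)) ≈ 0#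
    off j j≢ j≢′ with punchIn-adjacent j k j≢ j≢′
    ... | retains k′ p q = trans
      (*-congˡ (det-equal-adjacent-cols k′ (λ r s → A (suc r) (punchIn j s)) λ i →
        trans (reflexive (≡.cong (A (suc i)) p)) (trans (eq (suc i)) (reflexive (≡.cong (A (suc i)) (≡.sym q))))))
      (zeroʳ _)

    minors : ∀ r s → A (suc r) (punchIn (inject₁ k) s) ≈ A (suc r) (punchIn (suc k) s)
    minors r s with punchIn-inject₁-suc k s
    ... | inj₁ p       = reflexive (≡.cong (A (suc r)) p)
    ... | inj₂ (p , q) = trans (reflexive (≡.cong (A (suc r)) p))
                           (trans (sym (eq (suc r))) (reflexive (≡.cong (A (suc r)) (≡.sym q))))

    pair : pow (- 1#) (toℕ (inject₁ k)) * A zero (inject₁ k) * det n (λ r s → A (suc r) (punchIn (inject₁ k) s))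
           + pow (- 1#) (suc (toℕ k)) * A zero (suc k) * det n (λ r s → A (suc r) (punchIn (suc k) s)) ≈ 0#
    pair = trans (+-congʳ (*-cong (*-cong (pow-inject₁ _ k) (eq zero)) (det-cong minors)))
      (solve 3 (λ p a d → p :* a :* d :+ (:- con (+ 1)) :* p :* a :* d := con (+ 0)) refl _ _ _)

  -- Columns are indexed by all of ℕ, so that the neighbours of a column can be named without
  -- bounds; a determinant reads only the first `n`.
  Columns : ℕ → Set c
  Columns n = ℕ → Fin n → Carrier

  det-cols : ∀ {n} → Columns n → Carrier
  det-cols {n} F = det n (λ i j → F (toℕ j) i)

  det-cols-cong : ∀ {n} (F G : Columns n) → (∀ j → j ℕ.< n → ∀ i → F j i ≈ G j i) → det-cols F ≈ det-cols G
  det-cols-cong F G F≈G = det-cong λ i j → F≈G (toℕ j) (Finₚ.toℕ<n j) i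

  det-cols-linear : ∀ {n} k → k ℕ.< n → ∀ a b {F G H : Columns n} →
    (∀ i → F k i ≈ a * G k i + b * H k i) →
    (∀ j → j ≢ k → ∀ i → F j i ≈ G j i) → (∀ j → j ≢ k → ∀ i → F j i ≈ H j i) →
    det-cols F ≈ a * det-cols G + b * det-cols H
  det-cols-linear k k<n a b {F} {G} {H} at-k F≈G F≈H = det-col-linear (Fin.fromℕ< k<n) a b
    (λ i → ≡.subst (λ t → F t i ≈ a * G t i + b * H t i) (≡.sym (Finₚ.toℕ-fromℕ< k<n)) (at-k i))
    (λ i j j≢k → F≈G (toℕ j) (away j≢k) i)
    (λ i j j≢k → F≈H (toℕ j) (away j≢k) i)
    where
    away : ∀ {j} → j ≢ Fin.fromℕ< k<n → toℕ j ≢ k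
    away {j} j≢ eq = j≢ (Finₚ.toℕ-injective (≡.trans eq (≡.sym (Finₚ.toℕ-fromℕ< k<n))))

  det-cols-adjacent : ∀ {n} k → suc k ℕ.< n → (F : Columns n) →
    (∀ i → F k i ≈ F (suc k) i) → det-cols F ≈ 0#
  det-cols-adjacent {suc n} k (s≤s k<n) F eq = det-equal-adjacent-cols (Fin.fromℕ< k<n) (λ i j → F (toℕ j) i) λ i →
    ≡.subst₂ (λ s t → F s i ≈ F t i)
      (≡.sym (≡.trans (Finₚ.toℕ-inject₁ _) (Finₚ.toℕ-fromℕ< k<n)))
      (≡.cong suc (≡.sym (Finₚ.toℕ-fromℕ< k<n))) (eq i)

  replace : ∀ {n} → Columns n → ℕ → (Fin n → Carrier) → Columns n
  replace F k v j with j ℕ.≟ k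
  ... | yes _ = v
  ... | no  _ = F j

  replace-at : ∀ {n} (F : Columns n) k v → replace F k v k ≡ v
  replace-at F k v with k ℕ.≟ k
  ... | yes _  = ≡.refl
  ... | no k≢k = contradiction ≡.refl k≢k

  replace-away : ∀ {n} (F : Columns n) k v {j} → j ≢ k → replace F k v j ≡ F j
  replace-away F k v {j} j≢k with j ℕ.≟ k
  ... | yes j≡k = contradiction j≡k j≢k
  ... | no  _   = ≡.refl

  det-cols-scale : ∀ {n} k → k ℕ.< n → ∀ y {F G : Columns n} → (∀ j → j ≢ k → ∀ i → F j i ≈ G j i) →
    (∀ i → F k i ≈ y * G k i) → det-cols F ≈ y * det-cols G
  det-cols-scale k k<n y F≈G at-k = trans
    (det-cols-linear k k<n y 0# (λ i → trans (at-k i)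
      (solve 2 (λ y g → y :* g := y :* g :+ con (+ 0) :* g) refl _ _)) F≈G F≈G)
    (solve 2 (λ y g → y :* g :+ con (+ 0) :* g := y :* g) refl _ _)

  -- Linearity in column `k` leaves one extra determinant, in which column `k` is a copy of its
  -- neighbour `k′`.
  det-cols-add : ∀ {n} k k′ → k ℕ.< n → k′ ℕ.< n → (k′ ≡ suc k ⊎ k ≡ suc k′) → ∀ y c {F G : Columns n} →
    (∀ j → j ≢ k → ∀ i → F j i ≈ G j i) →
    (∀ i → F k i ≈ y * G k i + c * G k′ i) →
    det-cols F ≈ y * det-cols G
  det-cols-add {n} k k′ k<n k′<n adj y c {F} {G} F≈G at-k = begin
    det-cols F                         ≈⟨ det-cols-linear k k<n y c
                                            (λ i → trans (at-k i) (+-congˡ (*-congˡ (reflexive (≡.cong (λ v → v i) (≡.sym (replace-at G k (G k′))))))))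
                                            F≈G (λ j j≢k i → trans (F≈G j j≢k i) (reflexive (≡.cong (λ v → v i) (≡.sym (replace-away G k (G k′) j≢k))))) ⟩
    y * det-cols G + c * det-cols H    ≈⟨ +-congˡ (*-congˡ (H≈0 adj)) ⟩
    y * det-cols G + c * 0#            ≈⟨ solve 2 (λ g c → g :+ c :* con (+ 0) := g) refl _ _ ⟩
    y * det-cols G                     ∎
    where
    H : Columns n
    H = replace G k (G k′)

    k′≢k : (k′ ≡ suc k ⊎ k ≡ suc k′) → k′ ≢ k
    k′≢k (inj₁ ≡.refl) = ℕₚ.1+n≢n
    k′≢k (inj₂ ≡.refl) = ℕₚ.1+n≢n ∘ ≡.sym

    same : H k ≡ H k′
    same = ≡.trans (replace-at G k (G k′)) (≡.sym (replace-away G k (G k′) (k′≢k adj)))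

    H≈0 : (k′ ≡ suc k ⊎ k ≡ suc k′) → det-cols H ≈ 0#
    H≈0 (inj₁ ≡.refl) = det-cols-adjacent k k′<n H λ i → reflexive (≡.cong (λ v → v i) same)
    H≈0 (inj₂ ≡.refl) = det-cols-adjacent k′ k<n H λ i → reflexive (≡.cong (λ v → v i) (≡.sym same))

  splice : ∀ {n} → ℕ → Columns n → Columns n → Columns n
  splice zero    F G j       = G j
  splice (suc s) F G zero    = F zero
  splice (suc s) F G (suc j) = splice s (F ∘ suc) (G ∘ suc) j

  splice-< : ∀ {n} {F G : Columns n} {s j} → j ℕ.< s → splice s F G j ≡ F j
  splice-< {j = zero}  (s≤s j<s) = ≡.refl
  splice-< {j = suc j} (s≤s j<s) = splice-< j<s

  splice-≥ : ∀ {n} {F G : Columns n} {s j} → s ℕ.≤ j → splice s F G j ≡ G j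
  splice-≥ {s = zero}  _         = ≡.refl
  splice-≥ {s = suc s} (s≤s s≤j) = splice-≥ s≤j

  splice-suc : ∀ {n} {F G : Columns n} {s j} → j ≢ s → splice (suc s) F G j ≡ splice s F G j
  splice-suc {s = zero}  {zero}  j≢s = contradiction ≡.refl j≢s
  splice-suc {s = suc s} {zero}  j≢s = ≡.refl
  splice-suc {s = zero}  {suc j} j≢s = ≡.refl
  splice-suc {s = suc s} {suc j} j≢s = splice-suc (j≢s ∘ ≡.cong suc)

  prodℕ : ℕ → (ℕ → Carrier) → Carrier
  prodℕ zero    y = 1#
  prodℕ (suc n) y = y n * prodℕ n y

  prodℕ-cong : ∀ n {y z : ℕ → Carrier} → (∀ k → y k ≈ z k) → prodℕ n y ≈ prodℕ n z
  prodℕ-cong zero    y≈z = refl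
  prodℕ-cong (suc n) y≈z = *-cong (y≈z n) (prodℕ-cong n y≈z)

  prodℕ-1 : ∀ n → prodℕ n (λ _ → 1#) ≈ 1#
  prodℕ-1 zero    = refl
  prodℕ-1 (suc n) = trans (*-identityˡ _) (prodℕ-1 n)

  -- The change of columns is triangular with diagonal `y`. Columns are exchanged from the right, so
  -- that column `suc s` already belongs to `G` when column `s` is treated; the last column has no
  -- right neighbour and is only scaled.
  det-add-next : ∀ {n} (y c : ℕ → Carrier) (F G : Columns (suc n)) →
    (∀ j → j ℕ.< n → ∀ i → F j i ≈ y j * G j i + c j * G (suc j) i) →
    (∀ i → F n i ≈ y n * G n i) →
    det-cols F ≈ prodℕ (suc n) y * det-cols G
  det-add-next {n} y c F G step last = begin
    det-cols F                    ≈⟨ det-cols-cong F (splice (suc n) F G) (λ j j<n i → reflexive (≡.cong (λ v → v i) (≡.sym (splice-< {F = F} {G} j<n)))) ⟩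
    det-cols (splice (suc n) F G) ≈⟨ go (suc n) ℕₚ.≤-refl ⟩
    prodℕ (suc n) y * det-cols G  ∎
    where
    away : ∀ s j → j ≢ s → ∀ i → splice (suc s) F G j i ≈ splice s F G j i
    away s j j≢s i = reflexive (≡.cong (λ v → v i) (splice-suc j≢s))

    at : ∀ s i → splice (suc s) F G s i ≈ F s i
    at s i = reflexive (≡.cong (λ v → v i) (splice-< {F = F} {G} (ℕₚ.n<1+n s)))

    from : ∀ s {j} → s ℕ.≤ j → ∀ i → G j i ≈ splice s F G j i
    from s s≤j i = reflexive (≡.cong (λ v → v i) (≡.sym (splice-≥ {F = F} {G} s≤j)))

    one-step : ∀ s → s ℕ.≤ n → det-cols (splice (suc s) F G) ≈ y s * det-cols (splice s F G)
    one-step s s≤n with ℕₚ.m≤n⇒m<n∨m≡n s≤n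
    ... | inj₁ s<n = det-cols-add s (suc s) (s≤s s≤n) (s≤s s<n) (inj₁ ≡.refl) (y s) (c s) (away s) λ i →
      trans (at s i) (trans (step s s<n i)
        (+-cong (*-congˡ (from s ℕₚ.≤-refl i)) (*-congˡ (from s (ℕₚ.n≤1+n s) i))))
    ... | inj₂ ≡.refl = det-cols-scale s ℕₚ.≤-refl (y s) (away s) λ i →
      trans (at s i) (trans (last i) (*-congˡ (from s ℕₚ.≤-refl i)))

    go : ∀ s → s ℕ.≤ suc n → det-cols (splice s F G) ≈ prodℕ s y * det-cols G
    go zero    _         = sym (*-identityˡ _)
    go (suc s) (s≤s s≤n) = trans (one-step s s≤n) (trans (*-congˡ (go s (ℕₚ.m≤n⇒m≤1+n s≤n))) (sym (*-assoc _ _ _)))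

  -- The mirror image with unit diagonal: columns are exchanged from the left, so that the left
  -- neighbour already belongs to `G`.
  det-add-previous : ∀ {n} (c : ℕ → Carrier) (F G : Columns n) →
    (∀ i → F 0 i ≈ G 0 i) →
    (∀ j → suc j ℕ.< n → ∀ i → F (suc j) i ≈ G (suc j) i + c j * G j i) →
    det-cols F ≈ det-cols G
  det-add-previous {n} c F G first step = begin
    det-cols F              ≈⟨ go n ℕₚ.≤-refl ⟨
    det-cols (splice n G F) ≈⟨ det-cols-cong (splice n G F) G (λ j j<n i → reflexive (≡.cong (λ v → v i) (splice-< {F = G} {F} j<n))) ⟩
    det-cols G              ∎
    where
    away : ∀ s j → j ≢ s → ∀ i → splice s G F j i ≈ splice (suc s) G F j i
    away s j j≢s i = reflexive (≡.cong (λ v → v i) (≡.sym (splice-suc j≢s)))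

    at : ∀ s i → splice s G F s i ≈ F s i
    at s i = reflexive (≡.cong (λ v → v i) (splice-≥ {F = G} {F} (ℕₚ.≤-refl {s})))

    below : ∀ s {j} → j ℕ.≤ s → ∀ i → G j i ≈ splice (suc s) G F j i
    below s j≤s i = reflexive (≡.cong (λ v → v i) (≡.sym (splice-< {F = G} {F} (s≤s j≤s))))

    one-step : ∀ s → s ℕ.< n → det-cols (splice s G F) ≈ det-cols (splice (suc s) G F)
    one-step zero    s<n = trans
      (det-cols-scale 0 s<n 1# (away 0) λ i → trans (first i) (sym (*-identityˡ _))) (*-identityˡ _)
    one-step (suc s) s<n = trans
      (det-cols-add (suc s) s s<n (ℕₚ.<-trans (ℕₚ.n<1+n s) s<n) (inj₂ ≡.refl) 1# (c s) (away (suc s)) λ i →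
        trans (at (suc s) i) (trans (step s s<n i)
          (+-cong (trans (below (suc s) ℕₚ.≤-refl i) (sym (*-identityˡ _)))
                  (*-congˡ (below (suc s) (ℕₚ.n≤1+n s) i)))))
      (*-identityˡ _)

    go : ∀ s → s ℕ.≤ n → det-cols (splice s G F) ≈ det-cols F
    go zero    _   = refl
    go (suc s) s<n = trans (sym (one-step s s<n)) (go s (ℕₚ.<⇒≤ s<n))

  -- X s j is the s-th Newton basis vector shifted j times; staircase s X holds
  -- X j 0 in the columns j ≤ s and X s (j - s) in the later ones.
  staircase : ∀ {n} → ℕ → (ℕ → Columns n) → Columns n
  staircase zero    X j       = X 0 j
  staircase (suc s) X zero    = X 0 0
  staircase (suc s) X (suc j) = staircase s (X ∘ suc) j

  staircase-≤ : ∀ {n} s {X : ℕ → Columns n} {j} → j ℕ.≤ s → staircase s X j ≡ X j 0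
  staircase-≤ zero    {j = zero}  z≤n       = ≡.refl
  staircase-≤ (suc s) {j = zero}  _         = ≡.refl
  staircase-≤ (suc s) {j = suc j} (s≤s j≤s) = staircase-≤ s j≤s

  -- Equal to `r s` from position `s` on and to `0#` before: a step of the staircase leaves the
  -- columns up to `s` alone.
  threshold : (ℕ → Carrier) → ℕ → ℕ → Carrier
  threshold r zero    j       = r 0
  threshold r (suc s) zero    = 0#
  threshold r (suc s) (suc j) = threshold (r ∘ suc) s j

  staircase-step : ∀ {n} (r : ℕ → Carrier) {X : ℕ → Columns n} →
    (∀ k j i → X (suc k) j i ≈ X k (suc j) i + r k * X k j i) →
    ∀ s j i → staircase (suc s) X (suc j) i ≈ staircase s X (suc j) i + threshold r s j * staircase s X j i
  staircase-step r step zero    j       i = step 0 j i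
  staircase-step r {X} step (suc s) zero i = trans (reflexive (≡.cong (λ v → v i) (at-zero s)))
    (solve 2 (λ a b → a := a :+ con (+ 0) :* b) refl _ _)
    where
    at-zero : ∀ s → X 1 0 ≡ staircase s (X ∘ suc) 0
    at-zero zero    = ≡.refl
    at-zero (suc s) = ≡.refl
  staircase-step r step (suc s) (suc j) i = staircase-step (r ∘ suc) (step ∘ suc) s j i

  staircase-zero : ∀ {n} s (X : ℕ → Columns n) → staircase s X 0 ≡ X 0 0
  staircase-zero zero    X = ≡.refl
  staircase-zero (suc s) X = ≡.refl

  -- Passing from monomials to the Newton basis is unitriangular. It is done one root at a time,
  -- each root being a single round of adding multiples of previous columns.
  newton : ∀ {n} (r : ℕ → Carrier) (X : ℕ → Columns n) →
    (∀ k j i → X (suc k) j i ≈ X k (suc j) i + r k * X k j i) →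
    det-cols (X 0) ≈ det-cols (λ j → X j 0)
  newton {n} r X step = trans (sym (go n))
    (det-cols-cong (staircase n X) (λ j → X j 0) λ j j<n i → reflexive (≡.cong (λ v → v i) (staircase-≤ n {X} (ℕₚ.<⇒≤ j<n))))
    where
    go : ∀ s → det-cols (staircase s X) ≈ det-cols (X 0)
    go zero    = refl
    go (suc s) = trans
      (det-add-previous (threshold r s) (staircase (suc s) X) (staircase s X) (λ i → reflexive (≡.cong (λ v → v i) (≡.sym (staircase-zero s X))))
        (λ j _ i → staircase-step r step s j i))
      (go s)

  -- With the columns in decreasing order the lower basis vector is the next column instead of the
  -- previous one. Repeating the argument in this form avoids the sign of the reversal.
  newton-reversed : ∀ {n} (r : ℕ → Carrier) (X : ℕ → Columns (suc n)) →
    (∀ k j i → X (suc k) j i ≈ X k (suc j) i + r k * X k j i) →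
    det-cols (λ j → X 0 (n ℕ.∸ j)) ≈ det-cols (λ j → X (n ℕ.∸ j) 0)
  newton-reversed {n} r X step = trans (sym (go n))
    (det-cols-cong (λ j → staircase n X (n ℕ.∸ j)) (λ j → X (n ℕ.∸ j) 0) λ j j≤n i →
      reflexive (≡.cong (λ v → v i) (staircase-≤ n {X} (ℕₚ.m∸n≤m n j))))
    where
    go : ∀ s → det-cols (λ j → staircase s X (n ℕ.∸ j)) ≈ det-cols (λ j → X 0 (n ℕ.∸ j))
    go zero    = refl
    go (suc s) = trans
      (det-add-next (λ _ → 1#) (λ j → threshold r s (n ℕ.∸ suc j))
        (λ j → staircase (suc s) X (n ℕ.∸ j)) (λ j → staircase s X (n ℕ.∸ j)) next last)
      (trans (*-congʳ (prodℕ-1 (suc n))) (trans (*-identityˡ _) (go s)))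
      where
      next : ∀ j → j ℕ.< n → ∀ i → staircase (suc s) X (n ℕ.∸ j) i
        ≈ 1# * staircase s X (n ℕ.∸ j) i + threshold r s (n ℕ.∸ suc j) * staircase s X (n ℕ.∸ suc j) i
      next j j<n i rewrite ℕₚ.+-∸-assoc 1 j<n = trans (staircase-step r step s _ i) (+-congʳ (sym (*-identityˡ _)))

      last : ∀ i → staircase (suc s) X (n ℕ.∸ n) i ≈ 1# * staircase s X (n ℕ.∸ n) i
      last i rewrite ℕₚ.n∸n≡0 n = trans (reflexive (≡.cong (λ v → v i) (≡.sym (staircase-zero s X)))) (sym (*-identityˡ _))

-- The Vandermonde determinant in normalised form with integer exponents.

module Vandermonde {c ℓ} (R : CommutativeRing c ℓ) where
  open CommutativeRing R hiding (zero)
  open WithRing R using (sumFin; prodFin; det; pow)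
  open IntegerSolver R
  open Determinants R
  open import Relation.Binary.Reasoning.Setoid setoid

  vandermonde : ∀ k (w : Fin k → ℤ → Carrier) → (∀ r m n → w r (m ℤ.+ n) ≈ w r m * w r n) → (∀ r → w r (+ 0) ≈ 1#) →
    prodFin k (λ i → prodFin k (λ j → if toℕ i ℕ.<ᵇ toℕ j then 1# - w j (+ 1) * w i (ℤ.- (+ 1)) else 1#))
      ≈ det k (λ i j → w i (+ toℕ i ℤ.- + toℕ j))
  vandermonde zero    w w-+ w-0 = refl
  vandermonde (suc k) w w-+ w-0 = sym (begin
    det-cols F                                            ≈⟨ det-add-previous (λ _ → - t) F′ F (λ _ → refl) (λ _ _ _ → refl) ⟨
    det-cols F′                                           ≈⟨ +-congʳ (*-congʳ (trans (*-identityˡ _) (w-0 zero))) ⟩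
    1# * minor + sumFin k (λ j → pow (- 1#) (suc (toℕ j)) * F′ (suc (toℕ j)) zero * _)
      ≈⟨ +-cong (*-identityˡ _) (sumFin-zero {k} λ j → trans (*-congʳ (trans (*-congˡ {pow (- 1#) (suc (toℕ j))} (row₀ (toℕ j))) (zeroʳ _))) (zeroˡ _)) ⟩
    minor + 0#                                            ≈⟨ +-identityʳ _ ⟩
    minor                                                 ≈⟨ det-cong (λ r s → row r (toℕ s)) ⟩
    det k (λ r s → y r * w (suc r) (+ toℕ r ℤ.- + toℕ s)) ≈⟨ det-scale-rows y _ ⟩
    prodFin k y * det k (λ r s → w (suc r) (+ toℕ r ℤ.- + toℕ s))
      ≈⟨ *-cong (sym (*-identityˡ _)) (sym (vandermonde k (w ∘ suc) (w-+ ∘ suc) (w-0 ∘ suc))) ⟩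
    1# * prodFin k y * prodFin k (λ i → prodFin k (factor i))
      ≈⟨ *-congˡ (prodFin-cong {k} λ i → sym (*-identityˡ _)) ⟩
    1# * prodFin k y * prodFin k (λ i → 1# * prodFin k (factor i)) ∎)
    where
    t = w zero (ℤ.- (+ 1))

    F F′ : Columns (suc k)
    F j i = w i (+ toℕ i ℤ.- + j)
    F′ zero    = F 0
    F′ (suc j) = λ i → F (suc j) i + (- t) * F j i

    minor = det k (λ r s → F′ (suc (toℕ s)) (suc r))

    y : Fin k → Carrier
    y r = 1# - w (suc r) (+ 1) * t

    factor : Fin k → Fin k → Carrier
    factor i j = if toℕ i ℕ.<ᵇ toℕ j then 1# - w (suc j) (+ 1) * w (suc i) (ℤ.- (+ 1)) else 1#

    row₀ : ∀ j → F′ (suc j) zero ≈ 0#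
    row₀ j = begin
      w zero (+ 0 ℤ.- + suc j) + (- t) * w zero (+ 0 ℤ.- + j)
        ≡⟨ ≡.cong (λ e → w zero e + (- t) * w zero (+ 0 ℤ.- + j))
                  (ℤ-solve 1 (λ j → ⊚ (+ 0) ⊖ (⊚ (+ 1) ⊕ j) ⊜ ⊚ (ℤ.- (+ 1)) ⊕ (⊚ (+ 0) ⊖ j)) ≡.refl (+ j)) ⟩
      w zero (ℤ.- (+ 1) ℤ.+ (+ 0 ℤ.- + j)) + (- t) * w zero (+ 0 ℤ.- + j)
        ≈⟨ +-congʳ (w-+ zero (ℤ.- (+ 1)) (+ 0 ℤ.- + j)) ⟩
      t * w zero (+ 0 ℤ.- + j) + (- t) * w zero (+ 0 ℤ.- + j)
        ≈⟨ solve 2 (λ t x → t :* x :+ (:- t) :* x := con (+ 0)) refl _ _ ⟩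
      0# ∎

    row : ∀ r j → F′ (suc j) (suc r) ≈ y r * w (suc r) (+ toℕ r ℤ.- + j)
    row r j = begin
      w (suc r) (+ suc (toℕ r) ℤ.- + suc j) + (- t) * w (suc r) (+ suc (toℕ r) ℤ.- + j)
        ≡⟨ ≡.cong₂ (λ e f → w (suc r) e + (- t) * w (suc r) f)
             (ℤ-solve 2 (λ r j → (⊚ (+ 1) ⊕ r) ⊖ (⊚ (+ 1) ⊕ j) ⊜ r ⊖ j) ≡.refl (+ toℕ r) (+ j))
             (ℤ-solve 2 (λ r j → (⊚ (+ 1) ⊕ r) ⊖ j ⊜ ⊚ (+ 1) ⊕ (r ⊖ j)) ≡.refl (+ toℕ r) (+ j)) ⟩
      w (suc r) (+ toℕ r ℤ.- + j) + (- t) * w (suc r) (+ 1 ℤ.+ (+ toℕ r ℤ.- + j))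
        ≈⟨ +-congˡ (*-congˡ (w-+ (suc r) (+ 1) (+ toℕ r ℤ.- + j))) ⟩
      w (suc r) (+ toℕ r ℤ.- + j) + (- t) * (w (suc r) (+ 1) * w (suc r) (+ toℕ r ℤ.- + j))
        ≈⟨ solve 3 (λ t x z → x :+ (:- t) :* (z :* x) := (con (+ 1) :- z :* t) :* x) refl _ _ _ ⟩
      y r * w (suc r) (+ toℕ r ℤ.- + j) ∎

-- Laurent polynomials as formal sums, and the residue formula as a determinant.

Exponent : ℕ → Set
Exponent n = Fin n → ℤ

infixl 6 _⊞_
_⊞_ : ∀ {n} → Exponent n → Exponent n → Exponent n
(I ⊞ J) k = I k ℤ.+ J k

module Pairing {c ℓ} (R : CommutativeRing c ℓ) where
  open CommutativeRing R hiding (zero)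
  open IntegerSolver R
  open import Algebra.Properties.Ring ring using (-0#≈0#)
  open import Relation.Binary.Reasoning.Setoid setoid

  -- The value at P of the linear functional that sends t^I to T I.
  pair : ∀ {b} {B : Set b} {n} → (B → Carrier) → LPoly B n → (Exponent n → Carrier) → Carrier
  pair φ []            T = 0#
  pair φ ((a , I) ∷ P) T = φ a * T I + pair φ P T

  -- Exponents are functions, and arithmetic on them yields pointwise equalities only; functionals
  -- have to respect these.
  Extensional : ∀ {n} → (Exponent n → Carrier) → Set ℓ
  Extensional T = ∀ I J → (∀ k → I k ≡ J k) → T I ≈ T J

  module _ {b} {B : Set b} {n : ℕ} (φ : B → Carrier) where

    pair-cong : ∀ (P : LPoly B n) {S T} → (∀ I → S I ≈ T I) → pair φ P S ≈ pair φ P T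
    pair-cong []            S≈T = refl
    pair-cong ((a , I) ∷ P) S≈T = +-cong (*-congˡ (S≈T I)) (pair-cong P S≈T)

    pair-++ : ∀ (P Q : LPoly B n) T → pair φ (P ++ Q) T ≈ pair φ P T + pair φ Q T
    pair-++ []      Q T = sym (+-identityˡ _)
    pair-++ (_ ∷ P) Q T = trans (+-congˡ (pair-++ P Q T)) (sym (+-assoc _ _ _))

    pair-+ : ∀ (P : LPoly B n) S T → pair φ P (λ I → S I + T I) ≈ pair φ P S + pair φ P T
    pair-+ []            S T = sym (+-identityˡ _)
    pair-+ ((a , I) ∷ P) S T = trans (+-congˡ (pair-+ P S T))
      (solve 5 (λ a s t x y → a :* (s :+ t) :+ (x :+ y) := (a :* s :+ x) :+ (a :* t :+ y)) refl _ _ _ _ _)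

    pair-*ˡ : ∀ (P : LPoly B n) d T → pair φ P (λ I → d * T I) ≈ d * pair φ P T
    pair-*ˡ []            d T = sym (zeroʳ d)
    pair-*ˡ ((a , I) ∷ P) d T = trans (+-congˡ (pair-*ˡ P d T))
      (solve 4 (λ a d t x → a :* (d :* t) :+ d :* x := d :* (a :* t :+ x)) refl _ _ _ _)

    module _ (_·_ : B → B → B) (φ-· : ∀ a b → φ (a · b) ≈ φ a * φ b) where

      pair-map : ∀ a I {f} → (∀ d J → f (d , J) ≡ (a · d , I ⊞ J)) → ∀ (Q X : LPoly B n) T →
        pair φ (map f Q ++ X) T ≈ φ a * pair φ Q (λ J → T (I ⊞ J)) + pair φ X T
      pair-map a I f≡ [] X T = sym (trans (+-congʳ (zeroʳ _)) (+-identityˡ _))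
      pair-map a I {f} f≡ ((d , J) ∷ Q) X T rewrite f≡ d J = trans
        (+-cong (*-congʳ (φ-· a d)) (pair-map a I f≡ Q X T))
        (solve 5 (λ a d t q x → a :* d :* t :+ (a :* q :+ x) := a :* (d :* t :+ q) :+ x) refl _ _ _ _ _)

      pair-mul : ∀ (P Q : LPoly B n) T →
        pair φ (mulLP _·_ P Q) T ≈ pair φ P (λ I → pair φ Q (λ J → T (I ⊞ J)))
      pair-mul []            Q T = refl
      pair-mul ((a , I) ∷ P) Q T = trans (pair-map a I (λ _ _ → ≡.refl) Q (mulLP _·_ P Q) T) (+-congˡ (pair-mul P Q T))

  -- Interchanging two finite sums; this is what makes the product of formal sums commutative.
  pair-swap : ∀ {b b′} {B : Set b} {B′ : Set b′} {m n} (φ : B → Carrier) (ψ : B′ → Carrier)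
    (P : LPoly B m) (Q : LPoly B′ n) (T : Exponent m → Exponent n → Carrier) →
    pair φ P (λ I → pair ψ Q (T I)) ≈ pair ψ Q (λ J → pair φ P (λ I → T I J))
  pair-swap φ ψ []            Q T = zeros Q
    where
    zeros : ∀ Q → 0# ≈ pair ψ Q (λ _ → 0#)
    zeros []      = refl
    zeros (_ ∷ Q) = sym (trans (+-cong (zeroʳ _) (sym (zeros Q))) (+-identityˡ _))
  pair-swap φ ψ ((a , I) ∷ P) Q T = begin
    φ a * pair ψ Q (T I) + pair φ P (λ I → pair ψ Q (T I))
      ≈⟨ +-cong (sym (pair-*ˡ ψ Q (φ a) (T I))) (pair-swap φ ψ P Q T) ⟩
    pair ψ Q (λ J → φ a * T I J) + pair ψ Q (λ J → pair φ P (λ I → T I J))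
      ≈⟨ pair-+ ψ Q (λ J → φ a * T I J) (λ J → pair φ P (λ I → T I J)) ⟨
    pair ψ Q (λ J → φ a * T I J + pair φ P (λ I → T I J)) ∎

  eval : ∀ {n} → LPoly Carrier n → (Exponent n → Carrier) → Carrier
  eval = pair (λ a → a)

  eval-mul : ∀ {n} (P Q : LPoly Carrier n) T → eval (mulLP _*_ P Q) T ≈ eval P (λ I → eval Q (λ J → T (I ⊞ J)))
  eval-mul = pair-mul (λ a → a) _*_ (λ _ _ → refl)

  eval-extensional : ∀ {n} (Q : LPoly Carrier n) {T} → Extensional T → Extensional (λ I → eval Q (λ J → T (I ⊞ J)))
  eval-extensional Q T-ext I J I≡J = pair-cong _ Q λ K → T-ext (I ⊞ K) (J ⊞ K) λ k → ≡.cong (ℤ._+ K k) (I≡J k)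

  translate-extensional : ∀ {n} I {T : Exponent n → Carrier} → Extensional T → Extensional (λ J → T (I ⊞ J))
  translate-extensional I T-ext J K J≡K = T-ext (I ⊞ J) (I ⊞ K) λ k → ≡.cong (λ e → I k ℤ.+ e) (J≡K k)

  -- Formal sums are identified when no linear functional separates them.
  infix 4 _≋_
  _≋_ : ∀ {n} → LPoly Carrier n → LPoly Carrier n → Set (c ⊔ ℓ)
  P ≋ Q = ∀ T → Extensional T → eval P T ≈ eval Q T

  negLP : ∀ {n} → LPoly Carrier n → LPoly Carrier n
  negLP []            = []
  negLP ((a , I) ∷ P) = (- a , I) ∷ negLP P

  eval-neg : ∀ {n} (P : LPoly Carrier n) T → eval (negLP P) T ≈ - eval P T
  eval-neg []            T = sym -0#≈0#
  eval-neg ((a , I) ∷ P) T = trans (+-congˡ (eval-neg P T))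
    (solve 3 (λ a t p → (:- a) :* t :+ (:- p) := :- (a :* t :+ p)) refl _ _ _)

  one : ∀ {n} → LPoly Carrier n
  one = (1# , zeroExp) ∷ []

  eval-one : ∀ {n} (T : Exponent n → Carrier) → eval one T ≈ T zeroExp
  eval-one T = trans (+-identityʳ _) (*-identityˡ _)

  -- Formal sums are made into a ring so that the Vandermonde identity, proved over any commutative
  -- ring, can be used with the variables z_i themselves as entries.
  LaurentPolynomials : ℕ → CommutativeRing c (c ⊔ ℓ)
  LaurentPolynomials n = record
    { Carrier = LPoly Carrier n
    ; _≈_ = _≋_
    ; _+_ = _++_
    ; _*_ = mulLP _*_
    ; -_ = negLP
    ; 0# = []
    ; 1# = one
    ; isCommutativeRing = record
      { isRing = record
        { +-isAbelianGroup = record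
          { isGroup = record
            { isMonoid = record
              { isSemigroup = record
                { isMagma = record
                  { isEquivalence = record
                    { refl = λ T _ → refl
                    ; sym = λ P≋Q T e → sym (P≋Q T e)
                    ; trans = λ P≋Q Q≋R T e → trans (P≋Q T e) (Q≋R T e)
                    }
                  ; ∙-cong = λ {P} {P′} {Q} {Q′} P≋P′ Q≋Q′ T e →
                      trans (pair-++ _ P Q T) (trans (+-cong (P≋P′ T e) (Q≋Q′ T e)) (sym (pair-++ _ P′ Q′ T)))
                  }
                ; assoc = λ P Q S T e → begin
                    eval ((P ++ Q) ++ S) T             ≈⟨ pair-++ _ (P ++ Q) S T ⟩
                    eval (P ++ Q) T + eval S T         ≈⟨ +-congʳ (pair-++ _ P Q T) ⟩
                    eval P T + eval Q T + eval S T     ≈⟨ +-assoc _ _ _ ⟩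
                    eval P T + (eval Q T + eval S T)   ≈⟨ +-congˡ (pair-++ _ Q S T) ⟨
                    eval P T + eval (Q ++ S) T         ≈⟨ pair-++ _ P (Q ++ S) T ⟨
                    eval (P ++ (Q ++ S)) T             ∎
                }
              ; identity = (λ P T e → refl) , (λ P T e → trans (pair-++ _ P [] T) (+-identityʳ _))
              }
            ; inverse = (λ P T e → trans (pair-++ _ (negLP P) P T) (trans (+-congʳ (eval-neg P T)) (-‿inverseˡ _)))
                      , (λ P T e → trans (pair-++ _ P (negLP P) T) (trans (+-congˡ (eval-neg P T)) (-‿inverseʳ _)))
            ; ⁻¹-cong = λ {P} {Q} P≋Q T e → trans (eval-neg P T) (trans (-‿cong (P≋Q T e)) (sym (eval-neg Q T)))
            }
          ; comm = λ P Q T e → trans (pair-++ _ P Q T) (trans (+-comm _ _) (sym (pair-++ _ Q P T)))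
          }
        ; *-cong = λ {P} {P′} {Q} {Q′} P≋P′ Q≋Q′ T e → begin
            eval (mulLP _*_ P Q) T                       ≈⟨ eval-mul P Q T ⟩
            eval P (λ I → eval Q (λ J → T (I ⊞ J)))      ≈⟨ P≋P′ _ (eval-extensional Q e) ⟩
            eval P′ (λ I → eval Q (λ J → T (I ⊞ J)))     ≈⟨ pair-cong _ P′ (λ I → Q≋Q′ _ (translate-extensional I e)) ⟩
            eval P′ (λ I → eval Q′ (λ J → T (I ⊞ J)))    ≈⟨ eval-mul P′ Q′ T ⟨
            eval (mulLP _*_ P′ Q′) T                     ∎
        ; *-assoc = λ P Q S T e → begin
            eval (mulLP _*_ (mulLP _*_ P Q) S) T         ≈⟨ eval-mul (mulLP _*_ P Q) S T ⟩
            eval (mulLP _*_ P Q) (λ K → eval S (λ L → T (K ⊞ L)))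
              ≈⟨ eval-mul P Q _ ⟩
            eval P (λ I → eval Q (λ J → eval S (λ L → T (I ⊞ J ⊞ L))))
              ≈⟨ pair-cong _ P (λ I → pair-cong _ Q λ J → pair-cong _ S λ L → e (I ⊞ J ⊞ L) (I ⊞ (J ⊞ L)) λ k → ℤₚ.+-assoc (I k) (J k) (L k)) ⟩
            eval P (λ I → eval Q (λ J → eval S (λ L → T (I ⊞ (J ⊞ L)))))
              ≈⟨ pair-cong _ P (λ I → sym (eval-mul Q S _)) ⟩
            eval P (λ I → eval (mulLP _*_ Q S) (λ K → T (I ⊞ K)))
              ≈⟨ eval-mul P (mulLP _*_ Q S) T ⟨
            eval (mulLP _*_ P (mulLP _*_ Q S)) T         ∎
        ; *-identity = left-identity , λ P T e → trans (mul-comm P one T e) (left-identity P T e)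
        ; distrib = left-distrib , λ P Q S T e → trans (mul-comm (Q ++ S) P T e) (trans (left-distrib P Q S T e)
            (trans (pair-++ _ (mulLP _*_ P Q) (mulLP _*_ P S) T)
              (trans (+-cong (mul-comm P Q T e) (mul-comm P S T e))
                     (sym (pair-++ _ (mulLP _*_ Q P) (mulLP _*_ S P) T)))))
        }
      ; *-comm = mul-comm
      }
    }
    where
    mul-comm : ∀ P Q → mulLP _*_ P Q ≋ mulLP _*_ Q P
    mul-comm P Q T e = begin
      eval (mulLP _*_ P Q) T                     ≈⟨ eval-mul P Q T ⟩
      eval P (λ I → eval Q (λ J → T (I ⊞ J)))    ≈⟨ pair-swap _ _ P Q (λ I J → T (I ⊞ J)) ⟩
      eval Q (λ J → eval P (λ I → T (I ⊞ J)))    ≈⟨ pair-cong _ Q (λ J → pair-cong _ P λ I → e (I ⊞ J) (J ⊞ I) λ k → ℤₚ.+-comm (I k) (J k)) ⟩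
      eval Q (λ J → eval P (λ I → T (J ⊞ I)))    ≈⟨ eval-mul Q P T ⟨
      eval (mulLP _*_ Q P) T                     ∎

    left-identity : ∀ P → mulLP _*_ one P ≋ P
    left-identity P T e = trans (eval-mul one P T) (trans (eval-one (λ I → eval P (λ J → T (I ⊞ J))))
      (pair-cong _ P λ J → e (zeroExp ⊞ J) J λ k → ℤₚ.+-identityˡ (J k)))

    left-distrib : ∀ P Q S → mulLP _*_ P (Q ++ S) ≋ mulLP _*_ P Q ++ mulLP _*_ P S
    left-distrib P Q S T e = begin
      eval (mulLP _*_ P (Q ++ S)) T                          ≈⟨ eval-mul P (Q ++ S) T ⟩
      eval P (λ I → eval (Q ++ S) (λ J → T (I ⊞ J)))         ≈⟨ pair-cong _ P (λ I → pair-++ _ Q S _) ⟩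
      eval P (λ I → eval Q (λ J → T (I ⊞ J)) + eval S (λ J → T (I ⊞ J)))
        ≈⟨ pair-+ _ P _ _ ⟩
      eval P (λ I → eval Q (λ J → T (I ⊞ J))) + eval P (λ I → eval S (λ J → T (I ⊞ J)))
        ≈⟨ +-cong (eval-mul P Q T) (eval-mul P S T) ⟨
      eval (mulLP _*_ P Q) T + eval (mulLP _*_ P S) T        ≈⟨ pair-++ _ (mulLP _*_ P Q) (mulLP _*_ P S) T ⟨
      eval (mulLP _*_ P Q ++ mulLP _*_ P S) T                ∎

  module _ {p : ℕ} where
    open WithRing R using () renaming (det to detA; sumFin to sumA; prodFin to prodA; pow to powA)
    open WithRing (LaurentPolynomials p) using ()
      renaming (det to detL; sumFin to sumL; prodFin to prodL; pow to powL)
    private module L = CommutativeRing (LaurentPolynomials p)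

    monomial : Fin p → ℤ → LPoly Carrier p
    monomial r m = (1# , λ i → m ℤ.* unitExp r i) ∷ []

    -- The exponent of the product of the z_{ρ r}^{m r}, nested exactly as row expansion of a
    -- determinant produces it.
    monomials : ∀ {k} → (Fin k → Fin p) → (Fin k → ℤ) → Exponent p
    monomials {zero}  ρ m = zeroExp
    monomials {suc k} ρ m = (λ i → m zero ℤ.* unitExp (ρ zero) i) ⊞ monomials (ρ ∘ suc) (m ∘ suc)

    eval-monomial-mul : ∀ r m P T → eval (monomial r m L.* P) T ≈ eval P (λ J → T ((λ i → m ℤ.* unitExp r i) ⊞ J))
    eval-monomial-mul r m P T = trans (eval-mul (monomial r m) P T) (trans (+-identityʳ _) (*-identityˡ _))

    eval-sum : ∀ {k} (f : Fin k → LPoly Carrier p) T → eval (sumL k f) T ≈ sumA k (λ i → eval (f i) T)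
    eval-sum {zero}  f T = refl
    eval-sum {suc k} f T = trans (pair-++ _ (f zero) _ T) (+-congˡ (eval-sum (f ∘ suc) T))

    eval-sign : ∀ j P T → Extensional T → eval (powL (L.- L.1#) j L.* P) T ≈ powA (- 1#) j * eval P T
    eval-sign zero    P T e = trans (L.*-identityˡ P T e) (sym (*-identityˡ _))
    eval-sign (suc j) P T e = begin
      eval (powL (L.- L.1#) (suc j) L.* P) T
        ≈⟨ trans (L.*-assoc (L.- L.1#) (powL (L.- L.1#) j) P T e) (-1*x≈-x (powL (L.- L.1#) j L.* P) T e) ⟩
      eval (L.- (powL (L.- L.1#) j L.* P)) T  ≈⟨ eval-neg (powL (L.- L.1#) j L.* P) T ⟩
      - eval (powL (L.- L.1#) j L.* P) T      ≈⟨ -‿cong (eval-sign j P T e) ⟩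
      - (powA (- 1#) j * eval P T)            ≈⟨ solve 2 (λ a b → :- (a :* b) := (:- con (+ 1)) :* a :* b) refl _ _ ⟩
      powA (- 1#) (suc j) * eval P T          ∎
      where open import Algebra.Properties.Ring L.ring using (-1*x≈-x)

    -- A functional that is a product of one-variable functionals turns a determinant
    -- whose rows involve distinct variables into the determinant of its values.
    eval-det : ∀ {k} (ρ : Fin k → Fin p) (m : Fin k → Fin k → ℤ) (g : Fin k → ℤ → Carrier) κ T → Extensional T →
      (∀ e → T (monomials ρ e) ≈ κ * prodA k (λ r → g r (e r))) →
      eval (detL k (λ r s → monomial (ρ r) (m r s))) T ≈ κ * detA k (λ r s → g r (m r s))
    eval-det {zero}  ρ m g κ T e T≈ = trans (eval-one T) (T≈ λ ())
    eval-det {suc k} ρ m g κ T e T≈ = begin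
      eval (sumL (suc k) term) T                  ≈⟨ eval-sum term T ⟩
      sumA (suc k) (λ j → eval (term j) T)        ≈⟨ sumFin-cong step ⟩
      sumA (suc k) (λ j → κ * termA j)            ≈⟨ sumFin-linear κ 0# (λ j → solve 2 (λ a b → a :* b := a :* b :+ con (+ 0) :* con (+ 0)) refl κ (termA j)) ⟩
      κ * sumA (suc k) termA + 0# * _             ≈⟨ trans (+-congˡ (zeroˡ _)) (+-identityʳ _) ⟩
      κ * detA (suc k) (λ r s → g r (m r s))      ∎
      where
      open Determinants R
      minor : Fin (suc k) → LPoly Carrier p
      minor j = detL k (λ r s → monomial (ρ (suc r)) (m (suc r) (punchIn j s)))
      term : Fin (suc k) → LPoly Carrier p
      term j = (powL (L.- L.1#) (toℕ j) L.* monomial (ρ zero) (m zero j)) L.* minor j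
      minorA termA : Fin (suc k) → Carrier
      minorA j = detA k (λ r s → g (suc r) (m (suc r) (punchIn j s)))
      termA j = powA (- 1#) (toℕ j) * g zero (m zero j) * minorA j
      step : ∀ j → eval (term j) T ≈ κ * termA j
      step j = begin
        eval (term j) T
          ≈⟨ L.*-assoc (powL (L.- L.1#) (toℕ j)) (monomial (ρ zero) (m zero j)) (minor j) T e ⟩
        eval (powL (L.- L.1#) (toℕ j) L.* (monomial (ρ zero) (m zero j) L.* minor j)) T
          ≈⟨ eval-sign (toℕ j) (monomial (ρ zero) (m zero j) L.* minor j) T e ⟩
        powA (- 1#) (toℕ j) * eval (monomial (ρ zero) (m zero j) L.* minor j) T
          ≈⟨ *-congˡ (eval-monomial-mul (ρ zero) (m zero j) (minor j) T) ⟩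
        powA (- 1#) (toℕ j) * eval (minor j) (λ J → T ((λ i → m zero j ℤ.* unitExp (ρ zero) i) ⊞ J))
          -- The value of the row just expanded moves into the constant `κ`; the translated
          -- functional is then again a product over the remaining rows.
          ≈⟨ *-congˡ (eval-det (ρ ∘ suc) (λ r s → m (suc r) (punchIn j s)) (g ∘ suc) (κ * g zero (m zero j))
               (λ J → T ((λ i → m zero j ℤ.* unitExp (ρ zero) i) ⊞ J))
               (translate-extensional (λ i → m zero j ℤ.* unitExp (ρ zero) i) e) (λ d → trans (T≈ (cons (m zero j) d)) (sym (*-assoc _ _ _)))) ⟩
        powA (- 1#) (toℕ j) * (κ * g zero (m zero j) * minorA j)
          ≈⟨ solve 4 (λ p κ g d → p :* (κ :* g :* d) := κ :* (p :* g :* d)) refl _ _ _ _ ⟩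
        κ * termA j ∎
        where
        cons : ℤ → (Fin k → ℤ) → Fin (suc k) → ℤ
        cons a d zero    = a
        cons a d (suc r) = d r

  monomials-zero : ∀ {p k} (ρ : Fin k → Fin p) m → monomials (λ r → suc (ρ r)) m zero ≡ + 0
  monomials-zero {k = zero}  ρ m = ≡.refl
  monomials-zero {k = suc k} ρ m = ≡.cong₂ ℤ._+_ (ℤₚ.*-zeroʳ (m zero)) (monomials-zero (ρ ∘ suc) (m ∘ suc))

  monomials-suc : ∀ {p k} (ρ : Fin k → Fin p) m i → monomials (λ r → suc (ρ r)) m (suc i) ≡ monomials ρ m i
  monomials-suc {k = zero}  ρ m i = ≡.refl
  monomials-suc {k = suc k} ρ m i = ≡.cong (λ e → m zero ℤ.* unitExp (ρ zero) i ℤ.+ e) (monomials-suc (ρ ∘ suc) (m ∘ suc) i)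

  monomials-id : ∀ {p} (m : Fin p → ℤ) i → monomials (λ r → r) m i ≡ m i
  monomials-id m zero    = ≡.trans (≡.cong₂ ℤ._+_ (ℤₚ.*-identityʳ (m zero)) (monomials-zero (λ r → r) (m ∘ suc))) (ℤₚ.+-identityʳ (m zero))
  monomials-id m (suc i) = ≡.trans (≡.cong₂ ℤ._+_ (ℤₚ.*-zeroʳ (m zero)) (monomials-suc (λ r → r) (m ∘ suc) i))
    (≡.trans (ℤₚ.+-identityˡ _) (monomials-id (m ∘ suc) i))

  open WithRing R using (OneForm; IR; IR1; shiftForm; crossTerm; prodFin; det)

  module _ (p : ℕ) where
    private module L = CommutativeRing (LaurentPolynomials p)
    private module VL = Vandermonde (LaurentPolynomials p)
    open WithRing (LaurentPolynomials p) using () renaming (prodFin to prodL; det to detL)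

    monomial-+ : ∀ (r : Fin p) m n → monomial r (m ℤ.+ n) L.≈ monomial r m L.* monomial r n
    monomial-+ r m n T e = sym (trans (eval-monomial-mul r m (monomial r n) T)
      (+-congʳ (*-congˡ (e _ _ λ k → ≡.sym (ℤₚ.*-distribʳ-+ (unitExp r k) m n)))))

    monomial-0 : ∀ (r : Fin p) → monomial r (+ 0) L.≈ L.1#
    monomial-0 r T e = +-congʳ (*-congˡ (e _ _ λ k → ≡.refl))

    prodLP≋prodFin : ∀ m (f g : Fin m → LPoly Carrier p) → (∀ i → f i L.≈ g i) → prodLP _*_ 1# m f L.≈ prodL m g
    prodLP≋prodFin zero    f g f≈g = L.refl {L.1#}
    prodLP≋prodFin (suc m) f g f≈g = L.*-cong {f zero} {g zero} {prodLP _*_ 1# m (f ∘ suc)} {prodL m (g ∘ suc)}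
      (f≈g zero) (prodLP≋prodFin m (f ∘ suc) (g ∘ suc) (f≈g ∘ suc))

    crossFactor : ∀ b (i j : Fin p) →
      (if b then (1# , zeroExp) ∷ (- 1# , (λ k → unitExp j k ℤ.- unitExp i k)) ∷ [] else (1# , zeroExp) ∷ [])
        L.≈ (if b then L.1# L.- monomial j (+ 1) L.* monomial i (ℤ.- (+ 1)) else L.1#)
    crossFactor false i j = L.refl {L.1#}
    crossFactor true  i j T e = +-congˡ (+-congʳ (*-cong (-‿cong (sym (*-identityˡ _)))
      (e _ _ λ k → ≡.sym (≡.cong₂ ℤ._+_ (ℤₚ.*-identityˡ (unitExp j k)) (ℤₚ.-1*i≡-i (unitExp i k))))))

    crossTerm≋det : crossTerm p L.≈ detL p (λ i j → monomial i (+ toℕ i ℤ.- + toℕ j))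
    crossTerm≋det T e = trans
      (prodLP≋prodFin p _ (λ i → prodL p (factor i)) (λ i → prodLP≋prodFin p _ (factor i) λ j →
        crossFactor (toℕ i ℕ.<ᵇ toℕ j) i j) T e)
      (VL.vandermonde p monomial monomial-+ monomial-0 T e)
      where
      factor : Fin p → Fin p → LPoly Carrier p
      factor i j = if toℕ i ℕ.<ᵇ toℕ j then L.1# L.- monomial j (+ 1) L.* monomial i (ℤ.- (+ 1)) else L.1#

  IR≈eval : ∀ p (P : LPoly Carrier p) ω → IR p P ω ≈ eval P (λ m → prodFin p (λ j → IR1 (shiftForm (m j) (ω j))))
  IR≈eval p []      ω = refl
  IR≈eval p (_ ∷ P) ω = +-congˡ (IR≈eval p P ω)

  -- The iterated residue is linear in the cross term and, on a monomial, a product of residues in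
  -- separate variables. Row i of the Vandermonde determinant involves only z_i, so the residues can
  -- be taken entrywise.
  IR-crossTerm : ∀ p (ω : Fin p → OneForm) →
    IR p (crossTerm p) ω ≈ det p (λ i j → IR1 (shiftForm (+ toℕ i ℤ.- + toℕ j) (ω i)))
  IR-crossTerm p ω = begin
    IR p (crossTerm p) ω       ≈⟨ IR≈eval p (crossTerm p) ω ⟩
    eval (crossTerm p) T       ≈⟨ crossTerm≋det p T T-ext ⟩
    eval (detL p (λ i j → monomial i (+ toℕ i ℤ.- + toℕ j))) T
                               ≈⟨ eval-det (λ r → r) (λ i j → + toℕ i ℤ.- + toℕ j) g 1# T T-ext
                                    (λ e → trans (T-ext (monomials (λ r → r) e) e (monomials-id e)) (sym (*-identityˡ _))) ⟩
    1# * det p (λ i j → g i (+ toℕ i ℤ.- + toℕ j)) ≈⟨ *-identityˡ _ ⟩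
    det p (λ i j → g i (+ toℕ i ℤ.- + toℕ j)) ∎
    where
    open WithRing (LaurentPolynomials p) using () renaming (det to detL)
    g : Fin p → ℤ → Carrier
    g i m = IR1 (shiftForm m (ω i))
    T : Exponent p → Carrier
    T m = prodFin p (λ j → g j (m j))
    T-ext : Extensional T
    T-ext I J I≡J = Determinants.prodFin-cong R λ j → reflexive (≡.cong (g j) (I≡J j))

-- The Schur side as a determinant of iterated differences.

module SchurSide {c ℓ} (R : CommutativeRing c ℓ) where
  open CommutativeRing R hiding (zero)
  open WithRing R using (det; h; schur; 𝒮; int)
  open IntegerSolver R
  open Determinants R
  open Pairing R
  open import Relation.Binary.Reasoning.Setoid setoid
  open import Data.Bool using (T)

  Δ : (ℤ → Carrier) → ℤ → Carrier
  Δ F e = F e - F (+ 1 ℤ.+ e)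

  Δ^ : ℕ → (ℤ → Carrier) → ℤ → Carrier
  Δ^ zero    F = F
  Δ^ (suc k) F = Δ (Δ^ k F)

  Δ^-cong : ∀ k {F G} → (∀ e → F e ≈ G e) → ∀ e → Δ^ k F e ≈ Δ^ k G e
  Δ^-cong zero    F≈G e = F≈G e
  Δ^-cong (suc k) F≈G e = +-cong (Δ^-cong k F≈G e) (-‿cong (Δ^-cong k F≈G (+ 1 ℤ.+ e)))

  Δ^-translate : ∀ k F d e → Δ^ k (λ e → F (e ℤ.+ d)) e ≈ Δ^ k F (e ℤ.+ d)
  Δ^-translate zero    F d e = refl
  Δ^-translate (suc k) F d e = +-cong (Δ^-translate k F d e) (-‿cong
    (trans (Δ^-translate k F d (+ 1 ℤ.+ e)) (reflexive (≡.cong (Δ^ k F) (ℤₚ.+-assoc (+ 1) e d)))))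

  -- Records that row `k` is to be differenced `e` more times. The test is the one in `unitExp`, so
  -- the same rewriting settles both.
  bump : ∀ {n} → Fin n → ℕ → (Fin n → ℕ) → Fin n → ℕ
  bump k e a i = (if toℕ k ℕ.≡ᵇ toℕ i then e else 0) ℕ.+ a i

  bumps : ∀ {n} m → (Fin m → Fin n) → (Fin m → ℕ) → Fin n → ℕ
  bumps zero    ρ e = λ _ → 0
  bumps (suc m) ρ e = bump (ρ zero) (e zero) (bumps m (ρ ∘ suc) (e ∘ suc))

  binomial : ∀ {n} → Fin n → LPoly ℤ n
  binomial k = (+ 1 , zeroExp) ∷ (ℤ.- (+ 1) , unitExp k) ∷ []

  module _ {n : ℕ} (F : Fin n → Fin n → ℤ → Carrier) where

    Δdet : (Fin n → ℕ) → Exponent n → Carrier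
    Δdet a I = det n (λ i j → Δ^ (a i) (F i j) (I i))

    Δdet-cong : ∀ {a b I J} → (∀ i → a i ≡ b i) → (∀ i → I i ≡ J i) → Δdet a I ≈ Δdet b J
    Δdet-cong {a} {b} {I} {J} a≡b I≡J = det-cong λ i j →
      reflexive (≡.cong₂ (λ k e → Δ^ k (F i j) e) (a≡b i) (I≡J i))

    -- Multiplication by t_k moves the argument of row `k` only, so by linearity in that row the
    -- factor 1 - t_k becomes one more difference there.
    Δdet-step : ∀ k a I → Δdet a I - Δdet a (unitExp k ⊞ I) ≈ Δdet (bump k 1 a) I
    Δdet-step k a I = begin
      Δdet a I - Δdet a (unitExp k ⊞ I)                    ≈⟨ solve 2 (λ x y → x :- y := con (+ 1) :* x :+ con (ℤ.- (+ 1)) :* y) refl _ _ ⟩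
      1# * Δdet a I + (- 1#) * Δdet a (unitExp k ⊞ I)      ≈⟨ det-row-linear k 1# (- 1#) at-k (λ i j i≢k → off i j i≢k) (λ i j i≢k → off′ i j i≢k) ⟨
      Δdet (bump k 1 a) I                                  ∎
      where
      ≡ᵇ-refl : ∀ m → (m ℕ.≡ᵇ m) ≡ true
      ≡ᵇ-refl zero    = ≡.refl
      ≡ᵇ-refl (suc m) = ≡ᵇ-refl m

      ≢⇒≡ᵇ-false : ∀ i → i ≢ k → (toℕ k ℕ.≡ᵇ toℕ i) ≡ false
      ≢⇒≡ᵇ-false i i≢k with toℕ k ℕ.≡ᵇ toℕ i in eq
      ... | false = ≡.refl
      ... | true  = contradiction (≡.sym (Finₚ.toℕ-injective (ℕₚ.≡ᵇ⇒≡ (toℕ k) (toℕ i) (≡.subst T (≡.sym eq) _)))) i≢k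

      at-k : ∀ j → Δ^ (bump k 1 a k) (F k j) (I k)
        ≈ 1# * Δ^ (a k) (F k j) (I k) + (- 1#) * Δ^ (a k) (F k j) (unitExp k k ℤ.+ I k)
      at-k j rewrite ≡ᵇ-refl (toℕ k) = solve 2 (λ x y → x :- y := con (+ 1) :* x :+ con (ℤ.- (+ 1)) :* y) refl _ _

      off : ∀ i j → i ≢ k → Δ^ (bump k 1 a i) (F i j) (I i) ≈ Δ^ (a i) (F i j) (I i)
      off i j i≢k rewrite ≢⇒≡ᵇ-false i i≢k = refl

      off′ : ∀ i j → i ≢ k → Δ^ (bump k 1 a i) (F i j) (I i) ≈ Δ^ (a i) (F i j) (unitExp k i ℤ.+ I i)
      off′ i j i≢k rewrite ≢⇒≡ᵇ-false i i≢k = reflexive (≡.cong (Δ^ (a i) (F i j)) (≡.sym (ℤₚ.+-identityˡ (I i))))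

    int-1 : int (+ 1) ≈ 1#
    int-1 = +-identityʳ 1#

    pair-binomial : ∀ k a I → pair int (binomial k) (λ J → Δdet a (J ⊞ I)) ≈ Δdet (bump k 1 a) I
    pair-binomial k a I = begin
      int (+ 1) * Δdet a (zeroExp ⊞ I) + (- int (+ 1) * Δdet a (unitExp k ⊞ I) + 0#)
        ≈⟨ +-cong (*-cong int-1 (Δdet-cong {a} {J = I} (λ _ → ≡.refl) (λ i → ℤₚ.+-identityˡ (I i)))) (+-congʳ (*-congʳ (-‿cong int-1))) ⟩
      1# * Δdet a I + (- 1# * Δdet a (unitExp k ⊞ I) + 0#)
        ≈⟨ solve 2 (λ x y → con (+ 1) :* x :+ (con (ℤ.- (+ 1)) :* y :+ con (+ 0)) := x :- y) refl _ _ ⟩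
      Δdet a I - Δdet a (unitExp k ⊞ I)  ≈⟨ Δdet-step k a I ⟩
      Δdet (bump k 1 a) I                ∎

    pair-power : ∀ k e a I → pair int (powLP ℤ._*_ (+ 1) (binomial k) e) (λ J → Δdet a (J ⊞ I)) ≈ Δdet (bump k e a) I
    pair-power k zero a I = begin
      int (+ 1) * Δdet a (zeroExp ⊞ I) + 0#  ≈⟨ trans (+-identityʳ _) (trans (*-congʳ int-1) (*-identityˡ _)) ⟩
      Δdet a (zeroExp ⊞ I)                   ≈⟨ Δdet-cong {a} {bump k 0 a} a≡ (λ i → ℤₚ.+-identityˡ (I i)) ⟩
      Δdet (bump k 0 a) I                    ∎
      where
      a≡ : ∀ i → a i ≡ bump k 0 a i
      a≡ i with toℕ k ℕ.≡ᵇ toℕ i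
      ... | true  = ≡.refl
      ... | false = ≡.refl
    pair-power k (suc e) a I = begin
      pair int (mulLP ℤ._*_ (binomial k) (powLP ℤ._*_ (+ 1) (binomial k) e)) (λ J → Δdet a (J ⊞ I))
        ≈⟨ pair-mul int ℤ._*_ int-* (binomial k) (powLP ℤ._*_ (+ 1) (binomial k) e) _ ⟩
      pair int (binomial k) (λ J → pair int (powLP ℤ._*_ (+ 1) (binomial k) e) (λ K → Δdet a (J ⊞ K ⊞ I)))
        ≈⟨ pair-cong int (binomial k) (λ J → trans
             (pair-cong int (powLP ℤ._*_ (+ 1) (binomial k) e) λ K → Δdet-cong {a} {a} {J ⊞ K ⊞ I} {K ⊞ (J ⊞ I)} (λ _ → ≡.refl) λ i → exchange (J i) (K i) (I i))
             (pair-power k e a (J ⊞ I))) ⟩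
      pair int (binomial k) (λ J → Δdet (bump k e a) (J ⊞ I))
        ≈⟨ pair-binomial k (bump k e a) I ⟩
      Δdet (bump k 1 (bump k e a)) I
        ≈⟨ Δdet-cong {bump k 1 (bump k e a)} {bump k (suc e) a} a≡ (λ _ → ≡.refl) ⟩
      Δdet (bump k (suc e) a) I ∎
      where
      exchange : ∀ x y z → x ℤ.+ y ℤ.+ z ≡ y ℤ.+ (x ℤ.+ z)
      exchange = ℤ-solve 3 (λ x y z → x ⊕ y ⊕ z ⊜ y ⊕ (x ⊕ z)) ≡.refl

      a≡ : ∀ i → bump k 1 (bump k e a) i ≡ bump k (suc e) a i
      a≡ i with toℕ k ℕ.≡ᵇ toℕ i
      ... | true  = ≡.refl
      ... | false = ≡.refl

    -- By induction from the last factor: the inner factors have already raised the difference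
    -- orders when the first one acts. Starting from order 0 everywhere is what allows the Schur
    -- determinant to be plugged in.
    pair-product : ∀ m (ρ : Fin m → Fin n) (e : Fin m → ℕ) I →
      pair int (prodLP ℤ._*_ (+ 1) m (λ r → powLP ℤ._*_ (+ 1) (binomial (ρ r)) (e r))) (λ J → Δdet (λ _ → 0) (J ⊞ I))
        ≈ Δdet (bumps m ρ e) I
    pair-product zero ρ e I = trans (+-identityʳ _) (trans (*-congʳ int-1) (trans (*-identityˡ _)
      (Δdet-cong {λ _ → 0} {λ _ → 0} (λ _ → ≡.refl) (λ i → ℤₚ.+-identityˡ (I i)))))
    pair-product (suc m) ρ e I = begin
      pair int (mulLP ℤ._*_ P Q) (λ J → Δdet (λ _ → 0) (J ⊞ I))
        ≈⟨ pair-mul int ℤ._*_ int-* P Q _ ⟩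
      pair int P (λ J → pair int Q (λ K → Δdet (λ _ → 0) (J ⊞ K ⊞ I)))
        ≈⟨ pair-cong int P (λ J → trans
             (pair-cong int Q λ K → Δdet-cong {λ _ → 0} {λ _ → 0} {J ⊞ K ⊞ I} {K ⊞ (J ⊞ I)} (λ _ → ≡.refl) λ i → exchange (J i) (K i) (I i))
             (pair-product m (ρ ∘ suc) (e ∘ suc) (J ⊞ I))) ⟩
      pair int P (λ J → Δdet (bumps m (ρ ∘ suc) (e ∘ suc)) (J ⊞ I))
        ≈⟨ pair-power (ρ zero) (e zero) (bumps m (ρ ∘ suc) (e ∘ suc)) I ⟩
      Δdet (bumps (suc m) ρ e) I ∎
      where
      P Q : LPoly ℤ n
      P = powLP ℤ._*_ (+ 1) (binomial (ρ zero)) (e zero)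
      Q = prodLP ℤ._*_ (+ 1) m (λ r → powLP ℤ._*_ (+ 1) (binomial (ρ (suc r))) (e (suc r)))

      exchange : ∀ x y z → x ℤ.+ y ℤ.+ z ≡ y ℤ.+ (x ℤ.+ z)
      exchange = ℤ-solve 3 (λ x y z → x ⊕ y ⊕ z ⊜ y ⊕ (x ⊕ z)) ≡.refl

  𝒮≈pair : ∀ {M} (x : Fin M → Carrier) {n} (P : LPoly ℤ n) → 𝒮 x P ≈ pair int P (schur x n)
  𝒮≈pair x []      = refl
  𝒮≈pair x (_ ∷ P) = +-congˡ (𝒮≈pair x P)

  𝒮-rhsPoly : ∀ {M} (x : Fin M → Carrier) λs →
    𝒮 x (rhsPoly M λs) ≈ det (len M λs) (λ i j →
      Δ^ (bumps M (embed M λs) toℕ i) (h x) (padExp M λs i ℤ.+ + toℕ j ℤ.- + toℕ i))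
  𝒮-rhsPoly {M} x λs = begin
    𝒮 x (rhsPoly M λs)                       ≈⟨ 𝒮≈pair x (rhsPoly M λs) ⟩
    pair int (rhsPoly M λs) (schur x n)      ≈⟨ pair-mul int ℤ._*_ int-* ((+ 1 , pad) ∷ []) Q (schur x n) ⟩
    int (+ 1) * pair int Q (λ J → schur x n (pad ⊞ J)) + 0#
      ≈⟨ trans (+-identityʳ _) (trans (*-congʳ (+-identityʳ 1#)) (*-identityˡ _)) ⟩
    pair int Q (λ J → schur x n (pad ⊞ J))
      ≈⟨ pair-cong int Q (λ J → det-cong λ i j → reflexive (≡.cong (h x)
           (ℤ-solve 4 (λ p e j i → (p ⊕ e) ⊕ j ⊖ i ⊜ (e ⊕ p) ⊕ (j ⊖ i)) ≡.refl (pad i) (J i) (+ toℕ j) (+ toℕ i)))) ⟩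
    pair int Q (λ J → Δdet F (λ _ → 0) (J ⊞ pad))
      ≈⟨ pair-product F M (embed M λs) toℕ pad ⟩
    Δdet F (bumps M (embed M λs) toℕ) pad
      ≈⟨ det-cong (λ i j → trans (Δ^-translate (bumps M (embed M λs) toℕ i) (h x) (+ toℕ j ℤ.- + toℕ i) (pad i))
           (reflexive (≡.cong (Δ^ (bumps M (embed M λs) toℕ i) (h x)) (≡.sym (ℤₚ.+-assoc (pad i) (+ toℕ j) (ℤ.- + toℕ i)))))) ⟩
    det n (λ i j → Δ^ (bumps M (embed M λs) toℕ i) (h x) (pad i ℤ.+ + toℕ j ℤ.- + toℕ i)) ∎
    where
    n = len M λs
    pad = padExp M λs
    Q = prodLP ℤ._*_ (+ 1) M (λ r → powLP ℤ._*_ (+ 1) (binomial (embed M λs r)) (toℕ r))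
    F : Fin n → Fin n → ℤ → Carrier
    F i j e = h x (e ℤ.+ (+ toℕ j ℤ.- + toℕ i))

  bumps-below : ∀ {n} m (ρ : Fin m → Fin n) (e : Fin m → ℕ) d → (∀ r → toℕ (ρ r) ≡ d ℕ.+ toℕ r) →
    ∀ i → toℕ i ℕ.< d → bumps m ρ e i ≡ 0
  bumps-below zero    ρ e d ρ≡ i i<d = ≡.refl
  bumps-below (suc m) ρ e d ρ≡ i i<d with toℕ (ρ zero) ℕ.≡ᵇ toℕ i in eq
  ... | true  = contradiction (≡.trans (≡.sym (ℕₚ.≡ᵇ⇒≡ (toℕ (ρ zero)) (toℕ i) (≡.subst T (≡.sym eq) _)))
                  (≡.trans (ρ≡ zero) (ℕₚ.+-identityʳ d))) (ℕₚ.<⇒≢ i<d)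
  ... | false = bumps-below m (ρ ∘ suc) (e ∘ suc) (suc d) (λ r → ≡.trans (ρ≡ (suc r)) (ℕₚ.+-suc d (toℕ r))) i (ℕₚ.m<n⇒m<1+n i<d)

  -- The offset `d` is there for the recursion, in which the tail of `ρ` enumerates the rows from
  -- `suc d` on. Row `i` receives its exponent from exactly one factor; later factors miss it by
  -- `bumps-below`.
  bumps-at : ∀ {n} m (ρ : Fin m → Fin n) (e : Fin m → ℕ) d → (∀ r → toℕ (ρ r) ≡ d ℕ.+ toℕ r) → (∀ r → e r ≡ d ℕ.+ toℕ r) →
    ∀ i → d ℕ.≤ toℕ i → toℕ i ℕ.< d ℕ.+ m → bumps m ρ e i ≡ toℕ i
  bumps-at zero ρ e d ρ≡ e≡ i d≤i i<d = contradiction (ℕₚ.<-≤-trans i<d (ℕₚ.≤-trans (ℕₚ.≤-reflexive (ℕₚ.+-identityʳ d)) d≤i)) (ℕₚ.n≮n _)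
  bumps-at (suc m) ρ e d ρ≡ e≡ i d≤i i<d+m with toℕ (ρ zero) ℕ.≡ᵇ toℕ i in eq
  ... | true  = ≡.trans (≡.cong₂ ℕ._+_ (≡.trans (e≡ zero) (≡.trans (≡.sym (ρ≡ zero)) i≡))
                  (bumps-below m (ρ ∘ suc) (e ∘ suc) (suc d) (λ r → ≡.trans (ρ≡ (suc r)) (ℕₚ.+-suc d (toℕ r))) i
                    (s≤s (ℕₚ.≤-reflexive (≡.trans (≡.sym i≡) (≡.trans (ρ≡ zero) (ℕₚ.+-identityʳ d)))))))
                (ℕₚ.+-identityʳ _)
    where
    i≡ : toℕ (ρ zero) ≡ toℕ i
    i≡ = ℕₚ.≡ᵇ⇒≡ (toℕ (ρ zero)) (toℕ i) (≡.subst T (≡.sym eq) _)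
  ... | false = bumps-at m (ρ ∘ suc) (e ∘ suc) (suc d) (λ r → ≡.trans (ρ≡ (suc r)) (ℕₚ.+-suc d (toℕ r)))
                  (λ r → ≡.trans (e≡ (suc r)) (ℕₚ.+-suc d (toℕ r))) i
                  (ℕₚ.≤∧≢⇒< d≤i λ d≡i → ≡.subst T eq (ℕₚ.≡⇒≡ᵇ _ _ (≡.trans (ρ≡ zero) (≡.trans (ℕₚ.+-identityʳ d) d≡i))))
                  (ℕₚ.<-≤-trans i<d+m (ℕₚ.≤-reflexive (ℕₚ.+-suc d m)))

-- Formal expansions at 0 and infinity, and the one-variable residues.

module Residues {c ℓ} (R : CommutativeRing c ℓ) where
  open import Data.Nat.Combinatorics using (_C_; nCn≡1; nCk+nC[k+1]≡[n+1]C[k+1]; k>n⇒nCk≡0)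
  open CommutativeRing R hiding (zero)
  open WithRing R
  open Laurent
  open IntegerSolver R
  open import Relation.Binary.Reasoning.Setoid setoid

  sumℕ-linear : ∀ n a b {f g h : ℕ → Carrier} → (∀ i → f i ≈ a * g i + b * h i) →
                sumℕ n f ≈ a * sumℕ n g + b * sumℕ n h
  sumℕ-linear zero    a b f≈ = solve 2 (λ a b → con (+ 0) := a :* con (+ 0) :+ b :* con (+ 0)) refl a b
  sumℕ-linear (suc n) a b f≈ = trans (+-cong (f≈ 0) (sumℕ-linear n a b (f≈ ∘ suc)))
    (solve 6 (λ a b g h G H → a :* g :+ b :* h :+ (a :* G :+ b :* H) := a :* (g :+ G) :+ b :* (h :+ H))
           refl a b _ _ _ _)

  -- g = w^δ (a + b w) f in the local coordinate w.
  record Multiple (a b : Carrier) (δ : ℤ) (f g : Laurent) : Set ℓ where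
    field
      shift-+  : shift g ≡ shift f ℤ.+ δ
      coef-0   : coef g 0 ≈ a * coef f 0
      coef-suc : ∀ n → coef g (suc n) ≈ a * coef f (suc n) + b * coef f n
  open Multiple

  mulL-multipleˡ : ∀ {a b δ f g} h → Multiple a b δ f g → Multiple a b δ (mulL f h) (mulL g h)
  mulL-multipleˡ {a} {b} {δ} {f} {g} h r = record
    { shift-+ = ≡.trans (≡.cong (ℤ._+ shift h) (shift-+ r))
        (ℤ-solve 3 (λ s d t → (s ⊕ d) ⊕ t ⊜ (s ⊕ t) ⊕ d) ≡.refl (shift f) δ (shift h))
    ; coef-0 = trans (+-congʳ (*-congʳ (coef-0 r)))
        (solve 3 (λ a x y → a :* x :* y :+ con (+ 0) := a :* (x :* y :+ con (+ 0))) refl a _ _)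
    ; coef-suc = λ n → begin
        coef g 0 * coef h (suc n) + sumℕ (suc n) (λ i → coef g (suc i) * coef h (n ∸ i))
          ≈⟨ +-cong (*-congʳ (coef-0 r)) (sumℕ-linear (suc n) a b λ i → trans (*-congʳ (coef-suc r i))
               (solve 5 (λ a x b y z → (a :* x :+ b :* y) :* z := a :* (x :* z) :+ b :* (y :* z)) refl a (coef f (suc i)) b (coef f i) (coef h (n ∸ i)))) ⟩
        a * coef f 0 * coef h (suc n) + (a * sumℕ (suc n) (λ i → coef f (suc i) * coef h (n ∸ i)) + b * coef (mulL f h) n)
          ≈⟨ solve 5 (λ a x y s t → a :* x :* y :+ (a :* s :+ t) := a :* (x :* y :+ s) :+ t) refl _ _ _ _ _ ⟩
        a * coef (mulL f h) (suc n) + b * coef (mulL f h) n ∎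
    }

  convolution-multiple : ∀ {a b} (u f g : ℕ → Carrier) → g 0 ≈ a * f 0 → (∀ n → g (suc n) ≈ a * f (suc n) + b * f n) →
    ∀ n → sumℕ (suc (suc n)) (λ i → u i * g (suc n ∸ i))
          ≈ a * sumℕ (suc (suc n)) (λ i → u i * f (suc n ∸ i)) + b * sumℕ (suc n) (λ i → u i * f (n ∸ i))
  convolution-multiple {a} {b} u f g g₀ g₊ zero = trans
    (+-cong (*-congˡ (g₊ 0)) (+-congʳ (*-congˡ g₀)))
    (solve 6 (λ a b u v x y → u :* (a :* x :+ b :* y) :+ (v :* (a :* y) :+ con (+ 0))
                           := a :* (u :* x :+ (v :* y :+ con (+ 0))) :+ b :* (u :* y :+ con (+ 0))) refl a b _ _ _ _)
  convolution-multiple {a} {b} u f g g₀ g₊ (suc n) = trans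
    (+-cong (*-congˡ (g₊ (suc n))) (convolution-multiple (u ∘ suc) f g g₀ g₊ n))
    (solve 7 (λ a b u x y s t → u :* (a :* x :+ b :* y) :+ (a :* s :+ b :* t)
                             := a :* (u :* x :+ s) :+ b :* (u :* y :+ t)) refl a b (u 0) (f (suc (suc n))) (f (suc n)) _ _)

  mulL-multipleʳ : ∀ {a b δ f g} h → Multiple a b δ f g → Multiple a b δ (mulL h f) (mulL h g)
  mulL-multipleʳ {a} {b} {δ} {f} {g} h r = record
    { shift-+ = ≡.trans (≡.cong (λ s → shift h ℤ.+ s) (shift-+ r)) (≡.sym (ℤₚ.+-assoc (shift h) (shift f) δ))
    ; coef-0 = trans (+-congʳ (*-congˡ (coef-0 r)))
        (solve 3 (λ a x y → y :* (a :* x) :+ con (+ 0) := a :* (y :* x :+ con (+ 0))) refl a _ _)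
    ; coef-suc = convolution-multiple (coef h) (coef f) (coef g) (coef-0 r) (coef-suc r)
    }

  foldr-multiple : ∀ {a b δ f g} hs → Multiple a b δ f g → Multiple a b δ (foldr mulL f hs) (foldr mulL g hs)
  foldr-multiple []       r = r
  foldr-multiple (h ∷ hs) r = mulL-multipleʳ h (foldr-multiple hs r)

  -- Coefficients with an integer index, zero to the left, so that equations between indices can be
  -- rewritten.
  extend : (ℕ → Carrier) → ℤ → Carrier
  extend f (+ n)    = f n
  extend f -[1+ _ ] = 0#

  coeffL≡extend : ∀ f k → coeffL f k ≡ extend (coef f) (k ℤ.- shift f)
  coeffL≡extend f k with k ℤ.- shift f
  ... | + n      = ≡.refl
  ... | -[1+ n ] = ≡.refl

  extend-multiple : ∀ {a b δ f g} → Multiple a b δ f g →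
    ∀ k → extend (coef g) k ≈ a * extend (coef f) k + b * extend (coef f) (k ℤ.- + 1)
  extend-multiple {a} {b} r (+ zero)  = trans (coef-0 r) (solve 3 (λ a b x → a :* x := a :* x :+ b :* con (+ 0)) refl a b _)
  extend-multiple r (+ suc n) = coef-suc r n
  extend-multiple {a} {b} r -[1+ n ]  = solve 2 (λ a b → con (+ 0) := a :* con (+ 0) :+ b :* con (+ 0)) refl a b

  coeffL-multiple : ∀ {a b δ f g} → Multiple a b δ f g →
    ∀ k → coeffL g k ≈ a * coeffL f (k ℤ.- δ) + b * coeffL f (k ℤ.- δ ℤ.- + 1)
  coeffL-multiple {a} {b} {δ} {f} {g} r k = begin
    coeffL g k                                                ≡⟨ coeffL≡extend g k ⟩
    extend (coef g) (k ℤ.- shift g)                           ≡⟨ ≡.cong (λ s → extend (coef g) (k ℤ.- s)) (shift-+ r) ⟩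
    extend (coef g) (k ℤ.- (shift f ℤ.+ δ))                   ≈⟨ extend-multiple r (k ℤ.- (shift f ℤ.+ δ)) ⟩
    a * extend (coef f) (k ℤ.- (shift f ℤ.+ δ)) + b * extend (coef f) (k ℤ.- (shift f ℤ.+ δ) ℤ.- + 1)
      ≡⟨ ≡.cong₂ (λ s t → a * extend (coef f) s + b * extend (coef f) t)
           (ℤ-solve 3 (λ k s d → k ⊖ (s ⊕ d) ⊜ (k ⊖ d) ⊖ s) ≡.refl k (shift f) δ)
           (ℤ-solve 3 (λ k s d → k ⊖ (s ⊕ d) ⊖ ⊚ (+ 1) ⊜ (k ⊖ d ⊖ ⊚ (+ 1)) ⊖ s) ≡.refl k (shift f) δ) ⟩
    a * extend (coef f) (k ℤ.- δ ℤ.- shift f) + b * extend (coef f) (k ℤ.- δ ℤ.- + 1 ℤ.- shift f)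
      ≡⟨ ≡.cong₂ (λ s t → a * s + b * t) (coeffL≡extend f (k ℤ.- δ)) (coeffL≡extend f (k ℤ.- δ ℤ.- + 1)) ⟨
    a * coeffL f (k ℤ.- δ) + b * coeffL f (k ℤ.- δ ℤ.- + 1)   ∎

  monoL-translate : ∀ m d → Multiple 1# 0# d (monoL m) (monoL (m ℤ.+ d))
  monoL-translate m d = record
    { shift-+ = ≡.refl
    ; coef-0 = sym (*-identityˡ _)
    ; coef-suc = λ n → solve 1 (λ x → con (+ 0) := con (+ 1) :* con (+ 0) :+ con (+ 0) :* x) refl _
    }

  coeffL-translate : ∀ m d hs k → coeffL (foldr mulL (monoL (m ℤ.+ d)) hs) k ≈ coeffL (foldr mulL (monoL m) hs) (k ℤ.- d)
  coeffL-translate m d hs k = trans (coeffL-multiple (foldr-multiple hs (monoL-translate m d)) k)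
    (solve 2 (λ x y → con (+ 1) :* x :+ con (+ 0) :* y := x) refl _ _)

  -- The two local descriptions, at 0 and at infinity, of one rational function by which an
  -- integrand is multiplied.
  record Coefficients : Set c where
    constructor coefficients
    field
      a₀ b₀ : Carrier
      δ₀ : ℤ
      a∞ b∞ : Carrier
      δ∞ : ℤ

  times[1-_z] : Carrier → Coefficients
  times[1- c z] = coefficients 1# (- c) (+ 0) (- c) 1# (ℤ.- (+ 1))

  same : Coefficients
  same = coefficients 1# 0# (+ 0) 1# 0# (+ 0)

  record FactorMultiple (κ : Coefficients) (f g : Factor) : Set ℓ where
    open Coefficients κ
    field
      at-0 : Multiple a₀ b₀ δ₀ (at0 f) (at0 g)
      at-∞ : Multiple a∞ b∞ δ∞ (atInf f) (atInf g)

  record ProductMultiple (κ : Coefficients) (fs gs : List Factor) : Set ℓ where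
    open Coefficients κ
    field
      at-0 : ∀ m → Multiple a₀ b₀ δ₀ (foldr mulL (monoL m) (map at0 fs)) (foldr mulL (monoL m) (map at0 gs))
      at-∞ : ∀ m → Multiple a∞ b∞ δ∞ (foldr mulL (monoL m) (map atInf fs)) (foldr mulL (monoL m) (map atInf gs))

  head-multiple : ∀ {κ f g} fs → FactorMultiple κ f g → ProductMultiple κ (f ∷ fs) (g ∷ fs)
  head-multiple fs r = record { at-0 = λ m → mulL-multipleˡ _ at-0 ; at-∞ = λ m → mulL-multipleˡ _ at-∞ }
    where open FactorMultiple r

  cons-multiple : ∀ {κ fs gs} f → ProductMultiple κ fs gs → ProductMultiple κ (f ∷ fs) (f ∷ gs)
  cons-multiple f r = record
    { at-0 = λ m → mulL-multipleʳ (at0 f) (at-0 m) ; at-∞ = λ m → mulL-multipleʳ (atInf f) (at-∞ m) }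
    where open ProductMultiple r

  append-multiple : ∀ {κ fs gs} hs → ProductMultiple κ fs gs → ProductMultiple κ (hs ++ fs) (hs ++ gs)
  append-multiple []       r = r
  append-multiple (h ∷ hs) r = cons-multiple h (append-multiple hs r)

  -- Each residue is one coefficient of an expansion. The neighbouring coefficient picked up through
  -- the term - c z is traded for the monomial of exponent `+ 1 ℤ.+ m`.
  IR1-times : ∀ {c fs gs} → ProductMultiple times[1- c z] fs gs →
    ∀ m → IR1 (form m gs) ≈ IR1 (form m fs) - c * IR1 (form (+ 1 ℤ.+ m) fs)
  IR1-times {c} {fs} {gs} r m = begin
    coeffL (L₀ m gs) (ℤ.- (+ 1)) + - coeffL (L∞ (ℤ.- m) gs) (+ 1)
      ≈⟨ +-cong (coeffL-multiple (at-0 m) (ℤ.- (+ 1))) (-‿cong (coeffL-multiple (at-∞ (ℤ.- m)) (+ 1))) ⟩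
    1# * coeffL (L₀ m fs) (ℤ.- (+ 1)) + (- c) * coeffL (L₀ m fs) (ℤ.- (+ 1) ℤ.- + 1)
      + - ((- c) * coeffL (L∞ (ℤ.- m) fs) (+ 2) + 1# * coeffL (L∞ (ℤ.- m) fs) (+ 1))
      ≈⟨ +-cong (+-congˡ (*-congˡ move₀)) (-‿cong (+-congʳ (*-congˡ move∞))) ⟩
    1# * coeffL (L₀ m fs) (ℤ.- (+ 1)) + (- c) * coeffL (L₀ (+ 1 ℤ.+ m) fs) (ℤ.- (+ 1))
      + - ((- c) * coeffL (L∞ (ℤ.- (+ 1 ℤ.+ m)) fs) (+ 1) + 1# * coeffL (L∞ (ℤ.- m) fs) (+ 1))
      ≈⟨ solve 5 (λ c x y z w → con (+ 1) :* x :+ (:- c) :* y :+ :- ((:- c) :* z :+ con (+ 1) :* w)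
                              := x :+ (:- w) :- c :* (y :+ (:- z))) refl c _ _ _ _ ⟩
    IR1 (form m fs) - c * IR1 (form (+ 1 ℤ.+ m) fs) ∎
    where
    open ProductMultiple r
    L₀ L∞ : ℤ → List Factor → Laurent
    L₀ m hs = foldr mulL (monoL m) (map at0 hs)
    L∞ m hs = foldr mulL (monoL m) (map atInf hs)

    move₀ : coeffL (L₀ m fs) (ℤ.- (+ 1) ℤ.- + 1) ≈ coeffL (L₀ (+ 1 ℤ.+ m) fs) (ℤ.- (+ 1))
    move₀ = sym (trans (reflexive (≡.cong (λ m → coeffL (L₀ m fs) (ℤ.- (+ 1))) (ℤₚ.+-comm (+ 1) m)))
      (coeffL-translate m (+ 1) (map at0 fs) (ℤ.- (+ 1))))

    -- Multiplication by z = 1/w lowers indices at infinity by one, so the coefficient of w^2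
    -- becomes that of w.
    move∞ : coeffL (L∞ (ℤ.- m) fs) (+ 2) ≈ coeffL (L∞ (ℤ.- (+ 1 ℤ.+ m)) fs) (+ 1)
    move∞ = sym (trans (reflexive (≡.cong (λ m → coeffL (L∞ m fs) (+ 1))
        (ℤ-solve 1 (λ m → ⊝ (⊚ (+ 1) ⊕ m) ⊜ (⊝ m) ⊕ ⊚ (ℤ.- (+ 1))) ≡.refl m)))
      (coeffL-translate (ℤ.- m) (ℤ.- (+ 1)) (map atInf fs) (+ 1)))

  IR1-same : ∀ {fs gs} → ProductMultiple same fs gs → ∀ m → IR1 (form m gs) ≈ IR1 (form m fs)
  IR1-same r m = +-cong (trans (coeffL-multiple (at-0 m) (ℤ.- (+ 1))) drop)
                        (-‿cong (trans (coeffL-multiple (at-∞ (ℤ.- m)) (+ 1)) drop))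
    where
    open ProductMultiple r
    drop : ∀ {x y} → 1# * x + 0# * y ≈ x
    drop = solve 2 (λ x y → con (+ 1) :* x :+ con (+ 0) :* y := x) refl _ _

  nat-1 : nat 1 ≈ 1#
  nat-1 = +-identityʳ 1#

  nat-C0 : ∀ k → nat (k C 0) ≈ 1#
  nat-C0 k = nat-1

  nat-nCn : ∀ n → nat (n C n) ≈ 1#
  nat-nCn n = trans (reflexive (≡.cong nat (nCn≡1 n))) nat-1

  nat-pascal : ∀ n k → nat (suc n C suc k) ≈ nat (n C k) + nat (n C suc k)
  nat-pascal n k = trans (reflexive (≡.cong nat (≡.sym (nCk+nC[k+1]≡[n+1]C[k+1] n k)))) (nat-+ (n C k) (n C suc k))

  nat-0C : ∀ n → nat (0 C suc n) ≈ 0#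
  nat-0C n = reflexive (≡.cong nat (k>n⇒nCk≡0 {0} {suc n} (s≤s z≤n)))

  pow-1 : ∀ n → pow 1# n ≈ 1#
  pow-1 zero    = refl
  pow-1 (suc n) = trans (*-identityˡ _) (pow-1 n)

  posF-suc : ∀ k → FactorMultiple times[1- 1# z] (posF 1# k) (posF 1# (suc k))
  posF-suc k = record
    { at-0 = record
      { shift-+ = ≡.refl
      ; coef-0 = trans (*-congʳ (trans (nat-C0 (suc k)) (sym (nat-C0 k)))) (sym (*-identityˡ _))
      ; coef-suc = λ n → trans (*-congʳ (nat-pascal k n))
          (solve 3 (λ x y p → (x :+ y) :* (:- con (+ 1) :* p)
                  := con (+ 1) :* (y :* (:- con (+ 1) :* p)) :+ (:- con (+ 1)) :* (x :* p)) refl _ _ _)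
      }
    ; at-∞ = record
      { shift-+ = ℤ-solve 1 (λ k → ⊝ (⊚ (+ 1) ⊕ k) ⊜ (⊝ k) ⊕ ⊚ (ℤ.- (+ 1))) ≡.refl (+ k)
      ; coef-0 = trans (*-congʳ (trans (nat-C0 (suc k)) (sym (nat-C0 k))))
          (solve 2 (λ x p → x :* (:- con (+ 1) :* p) := :- con (+ 1) :* (x :* p)) refl _ _)
      ; coef-suc = λ n → trans (*-congʳ (nat-pascal k n)) (trans
          (solve 3 (λ x y p → (x :+ y) :* p := y :* p :+ con (+ 1) :* (x :* p)) refl _ _ _)
          (+-congʳ (top n)))
      }
    }
    where
    -- For n ≥ k both truncated exponents are 0 and no sign is gained, but then the binomial
    -- coefficient is 0.
    top : ∀ n → nat (k C suc n) * pow (- 1#) (k ∸ n) ≈ - 1# * (nat (k C suc n) * pow (- 1#) (k ∸ suc n))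
    top n with suc n ℕ.≤? k
    ... | yes n<k = trans (*-congˡ (reflexive (≡.cong (pow (- 1#)) (ℕₚ.+-∸-assoc 1 n<k))))
      (solve 2 (λ x p → x :* (:- con (+ 1) :* p) := :- con (+ 1) :* (x :* p)) refl _ _)
    ... | no n≮k = trans (*-congʳ nat≈0) (trans
      (solve 2 (λ p q → con (+ 0) :* p := :- con (+ 1) :* (con (+ 0) :* q)) refl _ _)
      (*-congˡ (*-congʳ (sym nat≈0))))
      where
      nat≈0 : nat (k C suc n) ≈ 0#
      nat≈0 = reflexive (≡.cong nat (k>n⇒nCk≡0 (ℕₚ.≰⇒> n≮k)))

  negF-suc : ∀ k → FactorMultiple times[1- 1# z] (negF 1# 1# (suc k)) (negF 1# 1# k)
  negF-suc k = record
    { at-0 = record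
      { shift-+ = ≡.refl
      ; coef-0 = sym (*-identityˡ _)
      ; coef-suc = λ n → trans (*-congˡ (trans (*-identityˡ _) (pow-1 n))) (trans
          (solve 2 (λ x y → y :* con (+ 1) := con (+ 1) :* ((x :+ y) :* con (+ 1)) :+ (:- con (+ 1)) :* (x :* con (+ 1))) refl _ _)
          (+-cong (*-congˡ (*-cong (sym (pascal n)) (sym (trans (*-identityˡ _) (pow-1 n))))) (*-congˡ (*-congˡ (sym (pow-1 n))))))
      }
    ; at-∞ = record
      { shift-+ = ℤ-solve 1 (λ k → ⊚ (+ 1) ⊕ k ⊜ (⊚ (+ 2) ⊕ k) ⊕ ⊚ (ℤ.- (+ 1))) ≡.refl (+ k)
      ; coef-0 = solve 2 (λ p x → p :* x := :- con (+ 1) :* (:- con (+ 1) :* p :* x)) refl _ _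
      ; coef-suc = λ n → trans (*-congˡ (*-congˡ (trans (*-identityˡ _) (pow-1 n)))) (trans
          (solve 3 (λ p x y → p :* (y :* con (+ 1)) := :- con (+ 1) :* (:- con (+ 1) :* p :* ((x :+ y) :* con (+ 1)))
                    :+ con (+ 1) :* (:- con (+ 1) :* p :* (x :* con (+ 1)))) refl _ _ _)
          (+-cong (*-congˡ (*-congˡ (*-cong (sym (pascal n)) (sym (trans (*-identityˡ _) (pow-1 n))))))
                  (*-congˡ (*-congˡ (*-congˡ (sym (pow-1 n)))))))
      }
    }
    where
    pascal : ∀ n → nat ((suc k ℕ.+ suc n) C suc n) ≈ nat ((suc k ℕ.+ n) C n) + nat ((k ℕ.+ suc n) C suc n)
    pascal n = trans (nat-pascal (k ℕ.+ suc n) n)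
      (+-congʳ (reflexive (≡.cong (λ N → nat (N C n)) (ℕₚ.+-suc k n))))

  -- The geometric series telescopes. At infinity its leading coefficient is - α⁻¹, which meets the
  -- factor - α; this is where invertibility enters.
  negF-cancel : ∀ {α α⁻¹} → α * α⁻¹ ≈ 1# → FactorMultiple times[1- α z] (negF α α⁻¹ 0) (posF 1# 0)
  negF-cancel {α} {α⁻¹} inverse = record
    { at-0 = record
      { shift-+ = ≡.refl
      ; coef-0 = sym (*-identityˡ _)
      ; coef-suc = λ n → begin
          nat (0 C suc n) * pow (- 1#) (suc n)       ≈⟨ trans (*-congʳ (nat-0C n)) (zeroˡ _) ⟩
          0#                                         ≈⟨ solve 2 (λ a p → con (+ 0) := con (+ 1) :* (con (+ 1) :* (a :* p)) :+ (:- a) :* (con (+ 1) :* p)) refl _ _ ⟩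
          1# * (1# * (α * pow α n)) + (- α) * (1# * pow α n)
            ≈⟨ +-cong (*-congˡ (*-congʳ (nat-nCn (suc n)))) (*-congˡ (*-congʳ (nat-nCn n))) ⟨
          1# * (nat (suc n C suc n) * pow α (suc n)) + (- α) * (nat (n C n) * pow α n) ∎
      }
    ; at-∞ = record
      { shift-+ = ≡.refl
      ; coef-0 = trans (*-congʳ nat-1) (trans (trans (*-identityˡ _) (trans (sym inverse)
          (solve 2 (λ a b → a :* b := :- a :* (:- b :* con (+ 1) :* (con (+ 1) :* con (+ 1)))) refl α α⁻¹)))
          (*-congˡ (*-congˡ (*-congʳ (sym nat-1)))))
      ; coef-suc = λ n → begin
          nat (0 C suc n) * 1#                       ≈⟨ trans (*-congʳ (nat-0C n)) (zeroˡ _) ⟩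
          0#                                         ≈⟨ solve 2 (λ b p → con (+ 0) := con (+ 1) :* (b :* p) :+ (:- b) :* (con (+ 1) :* p)) refl α⁻¹ (pow α⁻¹ n) ⟩
          1# * (α⁻¹ * pow α⁻¹ n) + (- α⁻¹) * (1# * pow α⁻¹ n)
            ≈⟨ +-congʳ (*-congʳ inverse) ⟨
          α * α⁻¹ * (α⁻¹ * pow α⁻¹ n) + (- α⁻¹) * (1# * pow α⁻¹ n)
            ≈⟨ solve 3 (λ a b p → a :* b :* (b :* p) :+ (:- b) :* (con (+ 1) :* p)
                 := :- a :* ((:- b :* con (+ 1)) :* (con (+ 1) :* (b :* p))) :+ con (+ 1) :* ((:- b :* con (+ 1)) :* (con (+ 1) :* p))) refl _ _ _ ⟩
          - α * ((- α⁻¹ * 1#) * (1# * (α⁻¹ * pow α⁻¹ n))) + 1# * ((- α⁻¹ * 1#) * (1# * pow α⁻¹ n))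
            ≈⟨ +-cong (*-congˡ (*-congˡ (*-congʳ (nat-nCn (suc n))))) (*-congˡ (*-congˡ (*-congʳ (nat-nCn n)))) ⟨
          - α * (pow (- α⁻¹) 1 * (nat (suc n C suc n) * pow α⁻¹ (suc n))) + 1# * (pow (- α⁻¹) 1 * (nat (n C n) * pow α⁻¹ n)) ∎
      }
    }

  oneMinusZ^-suc : ∀ e → FactorMultiple times[1- 1# z] (oneMinusZ^ e) (oneMinusZ^ (+ 1 ℤ.+ e))
  oneMinusZ^-suc (+ k)          = posF-suc k
  -- From exponent -1 to 0 the constructor changes: the pole cancels instead of dropping in order.
  oneMinusZ^-suc -[1+ zero ]    = negF-cancel (*-identityˡ 1#)
  oneMinusZ^-suc -[1+ suc k ]   = negF-suc k

  mulL-unit : ∀ u → shift u ≡ + 0 → coef u 0 ≈ 1# → (∀ n → coef u (suc n) ≈ 0#) → ∀ f → Multiple 1# 0# (+ 0) f (mulL u f)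
  mulL-unit u s u₀ u₊ f = record
    { shift-+ = ≡.trans (≡.cong (ℤ._+ shift f) s) (ℤₚ.+-comm (+ 0) (shift f))
    ; coef-0 = trans (+-identityʳ _) (*-congʳ u₀)
    ; coef-suc = λ n → +-cong (*-congʳ u₀) (trans (tail n (suc n)) (sym (zeroˡ _)))
    }
    where
    tail : ∀ n m → sumℕ m (λ i → coef u (suc i) * coef f (n ∸ i)) ≈ 0#
    tail n m = trans (sumℕ-linear m 0# 0# {g = λ _ → 0#} {λ _ → 0#} λ i → trans (*-congʳ (u₊ i))
        (solve 1 (λ x → con (+ 0) :* x := con (+ 0) :* con (+ 0) :+ con (+ 0) :* con (+ 0)) refl _))
      (solve 1 (λ x → con (+ 0) :* x :+ con (+ 0) :* x := con (+ 0)) refl _)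

  -- `posF 1# 0` is the constant 1. Cancelling a factor leaves it behind in the list, and this lemma
  -- removes it.
  unit-multiple : ∀ fs → ProductMultiple same fs (posF 1# 0 ∷ fs)
  unit-multiple fs = record
    { at-0 = λ m → mulL-unit (at0 (posF 1# 0)) ≡.refl (trans (*-identityʳ _) nat-1) (λ n → trans (*-congʳ (nat-0C n)) (zeroˡ _)) _
    ; at-∞ = λ m → mulL-unit (atInf (posF 1# 0)) ≡.refl (trans (*-identityʳ _) nat-1) (λ n → trans (*-congʳ (nat-0C n)) (zeroˡ _)) _
    }

  numerator : ℕ → List Factor
  numerator n = tabulate {n = n} (λ _ → posF 1# 1)

  -- The closing `posF 1# 0` is the power of 1 - z with exponent N' - N, which is 0 here.
  denominator : ∀ {M} → (x α : Fin M → Carrier) → List Factor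
  denominator x α = tabulate (λ a → negF (α a) (1# - x a) 0) ++ posF 1# 0 ∷ []

  -- ψ x α m e is the residue at 0 and ∞ of z^m (1-z)^e ∏ (1-z)/(1-α_a z) dz.
  ψ : ∀ {M} → (x α : Fin M → Carrier) → ℤ → ℤ → Carrier
  ψ {M} x α m e = IR1 (form m (oneMinusZ^ e ∷ numerator M ++ denominator x α))

  ψ-suc : ∀ {M} (x α : Fin M → Carrier) m e → ψ x α m (+ 1 ℤ.+ e) ≈ ψ x α m e - ψ x α (+ 1 ℤ.+ m) e
  ψ-suc {M} x α m e = trans (IR1-times (head-multiple (numerator M ++ denominator x α) (oneMinusZ^-suc e)) m)
    (+-congˡ (-‿cong (*-identityˡ _)))

  -- Since (1 - x_0)(1 - α_0 z) = (1 - x_0) - z = u - x_0, multiplying by u - x_0 cancels the first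
  -- denominator up to the constant 1 - x_0. The numerator 1 - z that belonged to it survives and
  -- raises the power of u by one.
  ψ-reduce : ∀ {M} (x α : Fin (suc M) → Carrier) → α zero * (1# - x zero) ≈ 1# → ∀ m e →
    ψ x α m (+ 1 ℤ.+ e) - x zero * ψ x α m e ≈ (1# - x zero) * ψ (x ∘ suc) (α ∘ suc) m (+ 1 ℤ.+ e)
  ψ-reduce {M} x α inverse m e = sym (begin
    y * ψ x′ α′ m (+ 1 ℤ.+ e)                                         ≈⟨ *-congˡ (ψ-suc x′ α′ m e) ⟩
    y * (ψ x′ α′ m e - ψ x′ α′ (+ 1 ℤ.+ m) e)                         ≈⟨ *-congˡ (+-cong (insert m) (-‿cong (insert (+ 1 ℤ.+ m)))) ⟨
    y * (IR1 (form m Y) - IR1 (form (+ 1 ℤ.+ m) Y))                   ≈⟨ *-congˡ (absorb m) ⟨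
    y * IR1 (form m X)                                                ≈⟨ *-congˡ (IR1-times (append-multiple (oneMinusZ^ e ∷ numerator (suc M)) (head-multiple (denominator x′ α′) (negF-cancel inverse))) m) ⟩
    y * (ψ x α m e - α zero * ψ x α (+ 1 ℤ.+ m) e)
      ≈⟨ solve 4 (λ y p a q → y :* (p :- a :* q) := y :* p :- (a :* y) :* q) refl _ _ _ _ ⟩
    y * ψ x α m e - (α zero * y) * ψ x α (+ 1 ℤ.+ m) e                ≈⟨ +-congˡ (-‿cong (*-congʳ inverse)) ⟩
    y * ψ x α m e - 1# * ψ x α (+ 1 ℤ.+ m) e
      ≈⟨ solve 3 (λ x p q → (con (+ 1) :- x) :* p :- con (+ 1) :* q := (p :- q) :- x :* p) refl _ _ _ ⟩
    (ψ x α m e - ψ x α (+ 1 ℤ.+ m) e) - x zero * ψ x α m e            ≈⟨ +-congʳ (ψ-suc x α m e) ⟨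
    ψ x α m (+ 1 ℤ.+ e) - x zero * ψ x α m e                          ∎)
    where
    y = 1# - x zero
    x′ α′ : Fin M → Carrier
    x′ = x ∘ suc
    α′ = α ∘ suc
    -- `X` is the integrand with its first denominator replaced by the constant 1; `Y` also lacks
    -- one numerator 1 - z.
    tail X Y : List Factor
    tail = numerator M ++ posF 1# 0 ∷ denominator x′ α′
    X = oneMinusZ^ e ∷ posF 1# 1 ∷ tail
    Y = oneMinusZ^ e ∷ tail

    insert : ∀ m → IR1 (form m Y) ≈ ψ x′ α′ m e
    insert = IR1-same (append-multiple (oneMinusZ^ e ∷ numerator M) (unit-multiple (denominator x′ α′)))

    pad : ∀ m → IR1 (form m (oneMinusZ^ e ∷ posF 1# 0 ∷ tail)) ≈ IR1 (form m Y)
    pad = IR1-same (cons-multiple (oneMinusZ^ e) (unit-multiple tail))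

    absorb : ∀ m → IR1 (form m X) ≈ IR1 (form m Y) - IR1 (form (+ 1 ℤ.+ m) Y)
    absorb m = trans (IR1-times (cons-multiple (oneMinusZ^ e) (head-multiple tail (posF-suc 0))) m)
      (+-cong (pad m) (-‿cong (trans (*-identityˡ _) (pad (+ 1 ℤ.+ m)))))

  -- A Laurent polynomial in z has no residues besides those at 0 and ∞.
  ψ-polynomial : ∀ (x α : Fin 0 → Carrier) m k → ψ x α m (+ k) ≈ 0#
  ψ-polynomial x α m (suc k) = trans (ψ-suc x α m (+ k))
    (trans (+-cong (ψ-polynomial x α m k) (-‿cong (ψ-polynomial x α (+ 1 ℤ.+ m) k))) (-‿inverseʳ 0#))
  ψ-polynomial x α m zero = begin
    ψ x α m (+ 0)          ≈⟨ IR1-same (unit-multiple (posF 1# 0 ∷ [])) m ⟩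
    IR1 (form m (posF 1# 0 ∷ [])) ≈⟨ IR1-same (unit-multiple []) m ⟩
    coeffL (monoL m) (ℤ.- (+ 1)) - coeffL (monoL (ℤ.- m)) (+ 1)
      ≡⟨ ≡.cong₂ (λ a b → a - b) (coeffL≡extend (monoL m) (ℤ.- (+ 1))) (coeffL≡extend (monoL (ℤ.- m)) (+ 1)) ⟩
    extend δ (ℤ.- (+ 1) ℤ.- m) - extend δ (+ 1 ℤ.- (ℤ.- m))
      ≡⟨ ≡.cong (λ t → extend δ (ℤ.- (+ 1) ℤ.- m) - extend δ t) (ℤ-solve 1 (λ m → ⊚ (+ 1) ⊖ (⊝ m) ⊜ ⊝ (⊚ (ℤ.- (+ 1)) ⊖ m)) ≡.refl m) ⟩
    extend δ (ℤ.- (+ 1) ℤ.- m) - extend δ (ℤ.- (ℤ.- (+ 1) ℤ.- m))   ≈⟨ even (ℤ.- (+ 1) ℤ.- m) ⟩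
    0#                     ∎
    where
    δ : ℕ → Carrier
    δ = coef (monoL (+ 0))

    -- The extended `δ` is the indicator of 0, an even function, so the residues of z^m dz at 0 and
    -- infinity cancel for every m.
    even : ∀ t → extend δ t - extend δ (ℤ.- t) ≈ 0#
    even (+ zero)  = -‿inverseʳ _
    even (+ suc n) = -‿inverseʳ _
    even -[1+ n ]  = -‿inverseʳ _

  shift-at0 : ∀ f → shift (at0 f) ≡ + 0
  shift-at0 (posF _ _)   = ≡.refl
  shift-at0 (negF _ _ _) = ≡.refl

  shift-at0-product : ∀ fs → shift (foldr mulL (monoL (+ 0)) (map at0 fs)) ≡ + 0
  shift-at0-product []       = ≡.refl
  shift-at0-product (f ∷ fs) = ≡.cong₂ ℤ._+_ (shift-at0 f) (shift-at0-product fs)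

  shift∞ : List Factor → ℤ
  shift∞ fs = shift (foldr mulL (monoL (+ 0)) (map atInf fs))

  shift∞-numerator : ∀ n fs → shift∞ (numerator n ++ fs) ≡ shift∞ fs ℤ.- + n
  shift∞-numerator zero    fs = ≡.sym (ℤₚ.+-identityʳ _)
  shift∞-numerator (suc n) fs = ≡.trans (≡.cong (λ s → ℤ.- (+ 1) ℤ.+ s) (shift∞-numerator n fs))
    (ℤ-solve 2 (λ n s → ⊚ (ℤ.- (+ 1)) ⊕ (s ⊖ n) ⊜ s ⊖ (⊚ (+ 1) ⊕ n)) ≡.refl (+ n) (shift∞ fs))

  shift∞-denominator : ∀ {M} (x α : Fin M → Carrier) → shift∞ (denominator x α) ≡ + M
  shift∞-denominator {zero}  x α = ≡.refl
  shift∞-denominator {suc M} x α = ≡.cong (λ s → + 1 ℤ.+ s) (shift∞-denominator (x ∘ suc) (α ∘ suc))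

  -- The form is regular at 0. At infinity the M numerators balance the M denominators, so the
  -- integrand vanishes to order at least 2 there, which absorbs the double pole of dz.
  ψ-low : ∀ {M} (x α : Fin M → Carrier) k → ψ x α (+ 0) -[1+ suc k ] ≈ 0#
  ψ-low {M} x α k = begin
    coeffL L₀ (ℤ.- (+ 1)) - coeffL L∞ (+ 1)
      ≡⟨ ≡.cong₂ (λ a b → a - b)
           (≡.trans (coeffL≡extend L₀ (ℤ.- (+ 1))) (≡.cong (λ s → extend (coef L₀) (ℤ.- (+ 1) ℤ.- s)) (shift-at0-product fs)))
           (≡.trans (coeffL≡extend L∞ (+ 1)) (≡.cong (λ s → extend (coef L∞) (+ 1 ℤ.- s)) total)) ⟩
    0# - 0#  ≈⟨ -‿inverseʳ 0# ⟩
    0#       ∎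
    where
    fs : List Factor
    fs = oneMinusZ^ -[1+ suc k ] ∷ numerator M ++ denominator x α

    L₀ L∞ : Laurent
    L₀ = foldr mulL (monoL (+ 0)) (map at0 fs)
    L∞ = foldr mulL (monoL (+ 0)) (map atInf fs)

    total : shift∞ fs ≡ + suc (suc k)
    total = ≡.trans (≡.cong (λ s → + suc (suc k) ℤ.+ s)
        (≡.trans (shift∞-numerator M (denominator x α)) (≡.trans (≡.cong (ℤ._- + M) (shift∞-denominator x α)) (ℤₚ.+-inverseʳ (+ M)))))
      (ℤₚ.+-identityʳ _)

  -- The form dz/(1 - z) has no pole at 0. At infinity 1/(1 - z) begins with - w, and the sign of
  -- the residue there turns this into 1.
  ψ-minus-one : ∀ (x α : Fin 0 → Carrier) → ψ x α (+ 0) -[1+ 0 ] ≈ 1#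
  ψ-minus-one x α = trans (IR1-same (cons-multiple (negF 1# 1# 0) (unit-multiple [])) (+ 0)) (begin
    0# - (pow (- 1#) 1 * (nat 1 * 1#) * 1# + 0#) ≈⟨ +-congˡ (-‿cong (+-congʳ (*-congʳ (*-congˡ (*-congʳ nat-1))))) ⟩
    0# - (pow (- 1#) 1 * (1# * 1#) * 1# + 0#)
      ≈⟨ solve 0 (con (+ 0) :- ((:- con (+ 1)) :* con (+ 1) :* (con (+ 1) :* con (+ 1)) :* con (+ 1) :+ con (+ 0)) := con (+ 1)) refl ⟩
    1# ∎)

  hN-suc : ∀ {M} (x : Fin (suc M) → Carrier) r → hN (suc M) x (suc r) ≈ hN M (x ∘ suc) (suc r) + x zero * hN (suc M) x r
  hN-suc {M} x r = +-cong (*-identityˡ _) (trans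
    (sumℕ-linear (suc r) (x zero) 0# λ i → solve 3 (λ x p t → x :* p :* t := x :* (p :* t) :+ con (+ 0) :* con (+ 0)) refl (x zero) (pow (x zero) i) (hN M (x ∘ suc) (r ∸ i)))
    (trans (+-congˡ (zeroˡ _)) (+-identityʳ _)))

  h-suc : ∀ {M} (x : Fin (suc M) → Carrier) e → h x (+ 1 ℤ.+ e) - x zero * h x e ≈ h (x ∘ suc) (+ 1 ℤ.+ e)
  h-suc {M} x (+ r)       = trans (+-congʳ (hN-suc x r)) (solve 2 (λ a b → a :+ b :- b := a) refl _ _)
  h-suc {M} x -[1+ zero ] = solve 2 (λ a b → con (+ 1) :* a :+ con (+ 0) :- b :* con (+ 0) := a) refl _ _
  h-suc {M} x -[1+ suc n ] = solve 1 (λ b → con (+ 0) :- b :* con (+ 0) := con (+ 0)) refl _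

  ψ≈h-suc : ∀ {M} (x α : Fin (suc M) → Carrier) → α zero * (1# - x zero) ≈ 1# → ∀ e →
    ψ x α (+ 0) e ≈ prodFin (suc M) (λ a → 1# - x a) * h x (+ 1 ℤ.+ e) →
    ψ (x ∘ suc) (α ∘ suc) (+ 0) (+ 1 ℤ.+ e) ≈ prodFin M (λ a → 1# - x (suc a)) * h (x ∘ suc) (+ 1 ℤ.+ (+ 1 ℤ.+ e)) →
    ψ x α (+ 0) (+ 1 ℤ.+ e) ≈ prodFin (suc M) (λ a → 1# - x a) * h x (+ 1 ℤ.+ (+ 1 ℤ.+ e))
  ψ≈h-suc {M} x α inverse e at-e below = begin
    ψ x α (+ 0) (+ 1 ℤ.+ e)
      ≈⟨ solve 2 (λ p q → p := (p :- q) :+ q) refl _ (x zero * ψ x α (+ 0) e) ⟩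
    (ψ x α (+ 0) (+ 1 ℤ.+ e) - x zero * ψ x α (+ 0) e) + x zero * ψ x α (+ 0) e
      ≈⟨ +-cong (trans (ψ-reduce x α inverse (+ 0) e) (*-congˡ below)) (*-congˡ at-e) ⟩
    (1# - x zero) * (P * h (x ∘ suc) (+ 1 ℤ.+ (+ 1 ℤ.+ e))) + x zero * ((1# - x zero) * P * h x (+ 1 ℤ.+ e))
      ≈⟨ +-congʳ (*-congˡ (*-congˡ (h-suc x (+ 1 ℤ.+ e)))) ⟨
    (1# - x zero) * (P * (h x (+ 1 ℤ.+ (+ 1 ℤ.+ e)) - x zero * h x (+ 1 ℤ.+ e))) + x zero * ((1# - x zero) * P * h x (+ 1 ℤ.+ e))
      ≈⟨ solve 5 (λ y P a x b → y :* (P :* (a :- x :* b)) :+ x :* (y :* P :* b) := y :* P :* a) refl _ _ _ _ _ ⟩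
    (1# - x zero) * P * h x (+ 1 ℤ.+ (+ 1 ℤ.+ e)) ∎
    where P = prodFin M (λ a → 1# - x (suc a))

  ψ≈h-minus-one : ∀ {M} (x α : Fin M → Carrier) → (∀ a → α a * (1# - x a) ≈ 1#) →
    ψ x α (+ 0) -[1+ 0 ] ≈ prodFin M (λ a → 1# - x a) * h x (+ 0)
  ψ≈h-minus-one {zero}  x α inverse = trans (ψ-minus-one x α) (sym (*-identityˡ _))
  ψ≈h-minus-one {suc M} x α inverse = ψ≈h-suc x α (inverse zero) -[1+ 1 ]
    (trans (ψ-low x α 0) (sym (zeroʳ _))) (ψ≈h-minus-one (x ∘ suc) (α ∘ suc) (inverse ∘ suc))

  -- Both sides obey the same recursion, from `ψ-reduce` and `h-suc`, linking exponent e + 1 to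
  -- exponent e and to one variable fewer. They agree at the start: both are zero for e ≤ -2, and
  -- without variables both are the indicator of e = -1.
  ψ≈h : ∀ {M} (x α : Fin M → Carrier) → (∀ a → α a * (1# - x a) ≈ 1#) → ∀ e →
    ψ x α (+ 0) e ≈ prodFin M (λ a → 1# - x a) * h x (+ 1 ℤ.+ e)
  ψ≈h {M}     x α inverse -[1+ suc k ] = trans (ψ-low x α k) (sym (zeroʳ _))
  ψ≈h {M}     x α inverse -[1+ zero ]  = ψ≈h-minus-one x α inverse
  ψ≈h {zero}  x α inverse (+ k)        = trans (ψ-polynomial x α (+ 0) k) (sym (zeroʳ _))
  ψ≈h {suc M} x α inverse (+ zero)     = ψ≈h-suc x α (inverse zero) -[1+ 0 ]
    (ψ≈h-minus-one x α inverse) (ψ≈h (x ∘ suc) (α ∘ suc) (inverse ∘ suc) (+ 0))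
  ψ≈h {suc M} x α inverse (+ suc k)    = ψ≈h-suc x α (inverse zero) (+ k)
    (ψ≈h x α inverse (+ k)) (ψ≈h (x ∘ suc) (α ∘ suc) (inverse ∘ suc) (+ suc k))

pos-∸ : ∀ {m n} → m ℕ.≤ n → + (n ℕ.∸ m) ≡ + n ℤ.- + m
pos-∸ {m} {n} m≤n = ≡.trans (≡.sym (ℤₚ.⊖-≥ m≤n)) (≡.sym (ℤₚ.m-n≡m⊖n n m))

-- Column operations modulo a monic polynomial in u.

module NewtonBasis {c ℓ} (R : CommutativeRing c ℓ) where
  open CommutativeRing R hiding (zero)
  open WithRing R using (prodFin; pow)
  open IntegerSolver R
  open Determinants R
  open SchurSide R using (Δ)
  open import Relation.Binary.Reasoning.Setoid setoid

  -- Sequences are linear functionals on Laurent polynomials in u via u^e ↦ F e;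
  -- ops r k precomposes with multiplication by (u - r 0) ⋯ (u - r (k-1)).
  op : Carrier → (ℤ → Carrier) → ℤ → Carrier
  op r F e = F (+ 1 ℤ.+ e) - r * F e

  ops : (ℕ → Carrier) → ℕ → (ℤ → Carrier) → ℤ → Carrier
  ops r zero    F = F
  ops r (suc k) F = ops (r ∘ suc) k (op (r 0) F)

  -- Induction on the variables x peels the first root, whereas the Newton recursion appends the
  -- last one.
  ops-last : ∀ r k F → ops r (suc k) F ≡ op (r k) (ops r k F)
  ops-last r zero    F = ≡.refl
  ops-last r (suc k) F = ops-last (r ∘ suc) k (op (r 0) F)

  ops-cong : ∀ r k {F G} → (∀ e → F e ≈ G e) → ∀ e → ops r k F e ≈ ops r k G e
  ops-cong r zero    F≈G = F≈G
  ops-cong r (suc k) F≈G = ops-cong (r ∘ suc) k λ e → +-cong (F≈G (+ 1 ℤ.+ e)) (-‿cong (*-congˡ (F≈G e)))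

  ops-scale-translate : ∀ r k a d F e → ops r k (λ e → a * F (d ℤ.+ e)) e ≈ a * ops r k F (d ℤ.+ e)
  ops-scale-translate r zero    a d F e = refl
  ops-scale-translate r (suc k) a d F e = trans
    (ops-cong (r ∘ suc) k (λ e → trans
      (+-congʳ (*-congˡ (reflexive (≡.cong F (ℤ-solve 2 (λ d e → d ⊕ (⊚ (+ 1) ⊕ e) ⊜ ⊚ (+ 1) ⊕ (d ⊕ e)) ≡.refl d e)))))
      (solve 4 (λ a x r y → a :* x :- r :* (a :* y) := a :* (x :- r :* y)) refl _ _ _ _)) e)
    (ops-scale-translate (r ∘ suc) k a d (op (r 0) F) e)

  ops-translate : ∀ r k d F e → ops r k (λ e → F (d ℤ.+ e)) e ≈ ops r k F (d ℤ.+ e)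
  ops-translate r k d F e = trans (ops-cong r k (λ e → sym (*-identityˡ _)) e)
    (trans (ops-scale-translate r k 1# d F e) (*-identityˡ _))

  -- Both operators are polynomials in the index shift with constant coefficients, hence commute.
  ops-Δ : ∀ r k F e → ops r k (Δ F) e ≈ Δ (ops r k F) e
  ops-Δ r zero    F e = refl
  ops-Δ r (suc k) F e = trans
    (ops-cong (r ∘ suc) k (λ e → solve 4 (λ x y z r → (x :- y) :- r :* (z :- x) := (x :- r :* z) :- (y :- r :* x)) refl _ _ _ _) e)
    (ops-Δ (r ∘ suc) k (op (r 0) F) e)

  ops-zero : ∀ q F e → ops (λ _ → 0#) q F e ≈ F (e ℤ.+ + q)
  ops-zero zero    F e = reflexive (≡.cong F (≡.sym (ℤₚ.+-identityʳ e)))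
  ops-zero (suc q) F e = trans (ops-zero q (op 0# F) e) (trans
    (solve 2 (λ x y → x :- con (+ 0) :* y := x) refl _ _)
    (reflexive (≡.cong F (ℤ-solve 2 (λ e q → ⊚ (+ 1) ⊕ (e ⊕ q) ⊜ e ⊕ (⊚ (+ 1) ⊕ q)) ≡.refl e (+ q)))))

  det-newton : ∀ {n} r (F : Fin n → ℤ → Carrier) →
    det-cols {n} (λ j i → F i (+ j)) ≈ det-cols {n} (λ j i → ops r j (F i) (+ 0))
  det-newton r F = newton (λ k → - r k) (λ k j i → ops r k (F i) (+ j)) λ k j i →
    trans (reflexive (≡.cong (λ G → G (+ j)) (ops-last r k (F i))))
      (solve 3 (λ x r y → x :- r :* y := x :+ (:- r) :* y) refl _ _ _)

  det-vanish : ∀ {n} r (F : Fin (suc n) → ℤ → Carrier) → (∀ i → ops r n (F i) (+ 0) ≈ 0#) →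
    det-cols {suc n} (λ j i → F i (+ j)) ≈ 0#
  det-vanish {n} r F F≈0 = trans (det-newton r F) (det-zero-col (Fin.fromℕ n) (λ i j → ops r (toℕ j) (F i) (+ 0)) λ i →
    trans (reflexive (≡.cong (λ k → ops r k (F i) (+ 0)) (Finₚ.toℕ-fromℕ n))) (F≈0 i))

  -- Multiplication by 1 - u is bidiagonal in the Newton basis.
  det-Δ : ∀ {n} r (F : Fin (suc n) → ℤ → Carrier) → (∀ i → ops r (suc n) (F i) (+ 0) ≈ 0#) →
    det-cols {suc n} (λ j i → Δ (F i) (+ j)) ≈ prodℕ (suc n) (λ k → 1# - r k) * det-cols {suc n} (λ j i → F i (+ j))
  det-Δ {n} r F F≈0 = begin
    det-cols (λ j i → Δ (F i) (+ j))                    ≈⟨ det-newton r (λ i → Δ (F i)) ⟩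
    det-cols (λ j i → ops r j (Δ (F i)) (+ 0))          ≈⟨ det-add-next (λ k → 1# - r k) (λ _ → - 1#) _ _ (λ j _ → step j) last ⟩
    prodℕ (suc n) (λ k → 1# - r k) * det-cols (λ j i → ops r j (F i) (+ 0))
                                                        ≈⟨ *-congˡ (det-newton r F) ⟨
    prodℕ (suc n) (λ k → 1# - r k) * det-cols (λ j i → F i (+ j)) ∎
    where
    step : ∀ j i → ops r j (Δ (F i)) (+ 0) ≈ (1# - r j) * ops r j (F i) (+ 0) + (- 1#) * ops r (suc j) (F i) (+ 0)
    step j i = trans (ops-Δ r j (F i) (+ 0)) (trans
      (solve 3 (λ x y r → x :- y := (con (+ 1) :- r) :* x :+ (:- con (+ 1)) :* (y :- r :* x)) refl _ _ (r j))
      (+-congˡ (*-congˡ (reflexive (≡.cong (λ G → G (+ 0)) (≡.sym (ops-last r j (F i))))))))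

    -- With N_k the Newton basis, (1 - u) N_n = (1 - r_n) N_n - N_{n+1}, and N_{n+1} is the
    -- polynomial that all rows kill.
    last : ∀ i → ops r n (Δ (F i)) (+ 0) ≈ (1# - r n) * ops r n (F i) (+ 0)
    last i = trans (step n i) (trans (+-congˡ (trans (*-congˡ (F≈0 i)) (zeroʳ _))) (+-identityʳ _))

  module _ {n : ℕ} (E : ℤ → ℤ → Fin (suc n) → Carrier)
    (E-suc : ∀ m e i → E (+ 1 ℤ.+ m) e i ≈ E m e i - E m (+ 1 ℤ.+ e) i) where

    det-shear-lower : det-cols (λ j → E (ℤ.- + j) (+ 0)) ≈ det-cols (λ j → E (ℤ.- + j) (+ j))
    det-shear-lower = trans (newton (λ _ → - 1#) X step)
      (det-cols-cong (λ j → X j 0) (λ j → E (ℤ.- + j) (+ j)) λ j _ i →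
        reflexive (≡.cong (λ k → E (ℤ.- + k) (+ j) i) (ℕₚ.+-identityʳ j)))
      where
      X : ℕ → Columns (suc n)
      X k j = E (ℤ.- + (k ℕ.+ j)) (+ k)

      step : ∀ k j i → X (suc k) j i ≈ X k (suc j) i + (- 1#) * X k j i
      step k j i = begin
        E m (+ suc k) i                                    ≈⟨ solve 2 (λ x y → x := y :- (y :- x)) refl _ (E m (+ k) i) ⟩
        E m (+ k) i - (E m (+ k) i - E m (+ suc k) i)      ≈⟨ +-congˡ (-‿cong (E-suc m (+ k) i)) ⟨
        E m (+ k) i - E (+ 1 ℤ.+ m) (+ k) i
          ≡⟨ ≡.cong₂ (λ a b → E a (+ k) i - E b (+ k) i) (≡.cong (λ t → ℤ.- (+ t)) (≡.sym (ℕₚ.+-suc k j)))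
               (ℤ-solve 1 (λ t → ⊚ (+ 1) ⊕ (⊝ (⊚ (+ 1) ⊕ t)) ⊜ ⊝ t) ≡.refl (+ (k ℕ.+ j))) ⟩
        X k (suc j) i - X k j i                            ≈⟨ solve 2 (λ x y → x :- y := x :+ (:- con (+ 1)) :* y) refl _ _ ⟩
        X k (suc j) i + (- 1#) * X k j i                   ∎
        where m = ℤ.- + suc (k ℕ.+ j)

    det-shear-upper : det-cols (λ j → E (ℤ.- + j) (+ j)) ≈ det-cols (λ j → E (ℤ.- + n) (+ j))
    det-shear-upper = begin
      det-cols (λ j → E (ℤ.- + j) (+ j))      ≈⟨ det-cols-cong (λ j → E (ℤ.- + j) (+ j)) (λ j → X 0 (n ℕ.∸ j)) (λ { j (s≤s j≤n) i → reflexive (≡.cong₂ (λ a b → E a b i)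
          (≡.trans (ℤ-solve 2 (λ n j → ⊝ j ⊜ (n ⊖ j) ⊖ n) ≡.refl (+ n) (+ j)) (≡.cong (ℤ._- + n) (≡.sym (pos-∸ j≤n))))
          (≡.trans (ℤ-solve 2 (λ n j → j ⊜ n ⊖ (n ⊖ j) ⊖ ⊚ (+ 0)) ≡.refl (+ n) (+ j)) (≡.cong (λ t → + n ℤ.- t ℤ.- + 0) (≡.sym (pos-∸ j≤n))))) }) ⟩
      det-cols (λ j → X 0 (n ℕ.∸ j))          ≈⟨ newton-reversed (λ _ → 1#) X step ⟩
      det-cols (λ j → X (n ℕ.∸ j) 0)          ≈⟨ det-cols-cong (λ j → X (n ℕ.∸ j) 0) (λ j → E (ℤ.- + n) (+ j)) (λ { j (s≤s j≤n) i → reflexive (≡.cong₂ (λ a b → E a b i)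
          (ℤₚ.+-identityˡ _)
          (≡.trans (≡.cong (λ t → + n ℤ.- + 0 ℤ.- t) (pos-∸ j≤n)) (ℤ-solve 2 (λ n j → n ⊖ ⊚ (+ 0) ⊖ (n ⊖ j) ⊜ j) ≡.refl (+ n) (+ j)))) }) ⟩
      det-cols (λ j → E (ℤ.- + n) (+ j))      ∎
      where
      X : ℕ → Columns (suc n)
      X k m = E (+ m ℤ.- + n) (+ n ℤ.- + m ℤ.- + k)

      step : ∀ k m i → X (suc k) m i ≈ X k (suc m) i + 1# * X k m i
      step k m i = begin
        E a e i                                          ≈⟨ solve 2 (λ x y → x := (x :- y) :+ con (+ 1) :* y) refl _ (E a (+ 1 ℤ.+ e) i) ⟩
        (E a e i - E a (+ 1 ℤ.+ e) i) + 1# * E a (+ 1 ℤ.+ e) i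
          ≈⟨ +-congʳ (E-suc a e i) ⟨
        E (+ 1 ℤ.+ a) e i + 1# * E a (+ 1 ℤ.+ e) i
          ≡⟨ ≡.cong₂ (λ p q → p + 1# * q)
               (≡.cong₂ (λ s t → E s t i) (≡.sym (ℤₚ.+-assoc (+ 1) (+ m) (ℤ.- + n)))
                 (ℤ-solve 3 (λ n m k → n ⊖ m ⊖ (⊚ (+ 1) ⊕ k) ⊜ n ⊖ (⊚ (+ 1) ⊕ m) ⊖ k) ≡.refl (+ n) (+ m) (+ k)))
               (≡.cong (λ t → E a t i) (ℤ-solve 3 (λ n m k → ⊚ (+ 1) ⊕ (n ⊖ m ⊖ (⊚ (+ 1) ⊕ k)) ⊜ n ⊖ m ⊖ k) ≡.refl (+ n) (+ m) (+ k))) ⟩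
        X k (suc m) i + 1# * X k m i                     ∎
        where
        a = + m ℤ.- + n
        e = + n ℤ.- + m ℤ.- + suc k

    det-advance : ∀ r → (∀ m i → ops r (suc n) (λ e → E m e i) (+ 0) ≈ 0#) → ∀ k m →
      det-cols (λ j → E (+ k ℤ.+ m) (+ j)) ≈ pow (prodℕ (suc n) (λ k → 1# - r k)) k * det-cols (λ j → E m (+ j))
    det-advance r E≈0 zero m = trans
      (det-cols-cong _ _ λ j _ i → reflexive (≡.cong (λ t → E t (+ j) i) (ℤₚ.+-identityˡ m))) (sym (*-identityˡ _))
    det-advance r E≈0 (suc k) m = begin
      det-cols (λ j → E (+ suc k ℤ.+ m) (+ j))
        ≈⟨ det-cols-cong _ _ (λ j _ i → trans (reflexive (≡.cong (λ t → E t (+ j) i) (ℤₚ.+-assoc (+ 1) (+ k) m))) (E-suc (+ k ℤ.+ m) (+ j) i)) ⟩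
      det-cols (λ j i → Δ (λ e → E (+ k ℤ.+ m) e i) (+ j))
        ≈⟨ det-Δ r (λ i e → E (+ k ℤ.+ m) e i) (E≈0 (+ k ℤ.+ m)) ⟩
      _ * det-cols (λ j → E (+ k ℤ.+ m) (+ j))              ≈⟨ *-congˡ (det-advance r E≈0 k m) ⟩
      _ * (_ * det-cols (λ j → E m (+ j)))                  ≈⟨ *-assoc _ _ _ ⟨
      _ * det-cols (λ j → E m (+ j))                        ∎

  -- The roots of Q: the x_a followed by zeros that bring the degree up to the number of columns. A
  -- zero root contributes the factor 1 to Q(1).
  pad : ∀ {M} → (Fin M → Carrier) → ℕ → Carrier
  pad {zero}  x _       = 0#
  pad {suc M} x zero    = x zero
  pad {suc M} x (suc k) = pad (x ∘ suc) k

  prodℕ-first : ∀ n y → prodℕ (suc n) y ≈ y 0 * prodℕ n (y ∘ suc)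
  prodℕ-first zero    y = refl
  prodℕ-first (suc n) y = trans (*-congˡ (prodℕ-first n y))
    (solve 3 (λ a b c → a :* (b :* c) := b :* (a :* c)) refl _ _ _)

  prodℕ-pad : ∀ {M} (x : Fin M → Carrier) q → prodℕ (M ℕ.+ q) (λ k → 1# - pad x k) ≈ prodFin M (λ a → 1# - x a)
  prodℕ-pad {zero}  x q = trans (prodℕ-cong q (λ k → solve 0 (con (+ 1) :- con (+ 0) := con (+ 1)) refl)) (prodℕ-1 q)
  prodℕ-pad {suc M} x q = trans (prodℕ-first (M ℕ.+ q) (λ k → 1# - pad x k)) (*-congˡ (prodℕ-pad (x ∘ suc) q))

-- Comparing the residue determinant with the difference determinant.

module Comparison {c ℓ} (R : CommutativeRing c ℓ) {M : ℕ} (x α : Fin M → CommutativeRing.Carrier R) where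
  open CommutativeRing R hiding (zero)
  open WithRing R using (det; h; pow; prodFin; form; oneMinusZ^; 𝒢mono)
  open IntegerSolver R
  open Determinants R
  open SchurSide R
  open Residues R
  open NewtonBasis R
  open import Relation.Binary.Reasoning.Setoid setoid

  pow-cong : ∀ {a b} k → a ≈ b → pow a k ≈ pow b k
  pow-cong zero    a≈b = refl
  pow-cong (suc k) a≈b = *-cong a≈b (pow-cong k a≈b)

  pow-inverse : ∀ {a b} k → a * b ≈ 1# → pow a k * pow b k ≈ 1#
  pow-inverse zero    ab≈1 = *-identityˡ _
  pow-inverse (suc k) ab≈1 = trans
    (solve 4 (λ a p b q → a :* p :* (b :* q) := (a :* b) :* (p :* q)) refl _ _ _ _)
    (trans (*-cong ab≈1 (pow-inverse k ab≈1)) (*-identityˡ _))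

  prodFin-const : ∀ n a → prodFin n (λ _ → a) ≈ pow a n
  prodFin-const zero    a = refl
  prodFin-const (suc n) a = *-congˡ (prodFin-const n a)

  prodFin-inverse : ∀ {n} {f g : Fin n → Carrier} → (∀ i → f i * g i ≈ 1#) → prodFin n f * prodFin n g ≈ 1#
  prodFin-inverse {zero}  fg≈1 = *-identityˡ _
  prodFin-inverse {suc n} fg≈1 = trans
    (solve 4 (λ a p b q → a :* p :* (b :* q) := (a :* b) :* (p :* q)) refl _ _ _ _)
    (trans (*-cong (fg≈1 zero) (prodFin-inverse (fg≈1 ∘ suc))) (*-identityˡ _))

  Δ^-scale-translate : ∀ k a F e → Δ^ k (λ e → a * F (+ 1 ℤ.+ e)) e ≈ a * Δ^ k F (+ 1 ℤ.+ e)
  Δ^-scale-translate zero    a F e = refl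
  Δ^-scale-translate (suc k) a F e = trans
    (+-cong (Δ^-scale-translate k a F e) (-‿cong (Δ^-scale-translate k a F (+ 1 ℤ.+ e))))
    (solve 3 (λ a x y → a :* x :- a :* y := a :* (x :- y)) refl _ _ _)

  -- A difference looks only upwards in the index, so vanishing on an upward ray is inherited.
  Δ^-zero : ∀ k F e → (∀ j → F (+ j ℤ.+ e) ≈ 0#) → ∀ j → Δ^ k F (+ j ℤ.+ e) ≈ 0#
  Δ^-zero zero    F e F≈0 = F≈0
  Δ^-zero (suc k) F e F≈0 j = trans
    (+-cong (Δ^-zero k F e F≈0 j) (-‿cong (trans (reflexive (≡.cong (Δ^ k F) (≡.sym (ℤₚ.+-assoc (+ 1) (+ j) e)))) (Δ^-zero k F e F≈0 (suc j)))))
    (-‿inverseʳ 0#)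

  ops-Δ^ : ∀ r k a F e → ops r k (Δ^ a F) e ≈ Δ^ a (ops r k F) e
  ops-Δ^ r k zero    F e = refl
  ops-Δ^ r k (suc a) F e = trans (ops-Δ r k (Δ^ a F) e)
    (+-cong (ops-Δ^ r k a F e) (-‿cong (ops-Δ^ r k a F (+ 1 ℤ.+ e))))

  -- This is z^k = (1 - u)^k read through the functional.
  ψ-Δ^ : ∀ k e → ψ x α (+ k) e ≈ Δ^ k (ψ x α (+ 0)) e
  ψ-Δ^ zero    e = refl
  ψ-Δ^ (suc k) e = trans
    (solve 2 (λ p q → p := q :- (q :- p)) refl _ (ψ x α (+ k) e))
    (trans (+-congˡ (-‿cong (sym (ψ-suc x α (+ k) e)))) (+-cong (ψ-Δ^ k e) (-‿cong (ψ-Δ^ k (+ 1 ℤ.+ e)))))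

  -- Each factor u - x_a cancels a denominator and raises the exponent of u by one; the q zero roots
  -- multiply by u^q. What is left is a Laurent polynomial in z, as u has the nonnegative exponent
  -- `k`.
  ops-ψ : ∀ {M} (x α : Fin M → Carrier) → (∀ a → α a * (1# - x a) ≈ 1#) → ∀ q m e k → e ℤ.+ + (M ℕ.+ q) ≡ + k →
    ops (pad x) (M ℕ.+ q) (ψ x α m) e ≈ 0#
  ops-ψ {zero}  x α inverse q m e k eq = trans (ops-zero q (ψ x α m) e)
    (trans (reflexive (≡.cong (ψ x α m) eq)) (ψ-polynomial x α m k))
  ops-ψ {suc M} x α inverse q m e k eq = begin
    ops (pad (x ∘ suc)) (M ℕ.+ q) (op (x zero) (ψ x α m)) e
      ≈⟨ ops-cong (pad (x ∘ suc)) (M ℕ.+ q) (ψ-reduce x α (inverse zero) m) e ⟩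
    ops (pad (x ∘ suc)) (M ℕ.+ q) (λ e → (1# - x zero) * ψ (x ∘ suc) (α ∘ suc) m (+ 1 ℤ.+ e)) e
      ≈⟨ ops-scale-translate (pad (x ∘ suc)) (M ℕ.+ q) (1# - x zero) (+ 1) (ψ (x ∘ suc) (α ∘ suc) m) e ⟩
    (1# - x zero) * ops (pad (x ∘ suc)) (M ℕ.+ q) (ψ (x ∘ suc) (α ∘ suc) m) (+ 1 ℤ.+ e)
      ≈⟨ *-congˡ (ops-ψ (x ∘ suc) (α ∘ suc) (inverse ∘ suc) q m (+ 1 ℤ.+ e) k (≡.trans
           (ℤ-solve 2 (λ e s → (⊚ (+ 1) ⊕ e) ⊕ s ⊜ e ⊕ (⊚ (+ 1) ⊕ s)) ≡.refl e (+ (M ℕ.+ q))) eq)) ⟩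
    (1# - x zero) * 0#   ≈⟨ zeroʳ _ ⟩
    0#                   ∎

  -- Multiplying by the factors u - x_a removes all variables. The index has to end strictly above
  -- 0, since h_0 of no variables is 1.
  ops-h : ∀ {M} (x : Fin M → Carrier) q e k → e ℤ.+ + (M ℕ.+ q) ≡ + suc k → ops (pad x) (M ℕ.+ q) (h x) e ≈ 0#
  ops-h {zero}  x q e k eq = trans (ops-zero q (h x) e) (reflexive (≡.cong (h x) eq))
  ops-h {suc M} x q e k eq = begin
    ops (pad (x ∘ suc)) (M ℕ.+ q) (op (x zero) (h x)) e                ≈⟨ ops-cong (pad (x ∘ suc)) (M ℕ.+ q) (h-suc x) e ⟩
    ops (pad (x ∘ suc)) (M ℕ.+ q) (λ e → h (x ∘ suc) (+ 1 ℤ.+ e)) e    ≈⟨ ops-translate (pad (x ∘ suc)) (M ℕ.+ q) (+ 1) (h (x ∘ suc)) e ⟩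
    ops (pad (x ∘ suc)) (M ℕ.+ q) (h (x ∘ suc)) (+ 1 ℤ.+ e)            ≈⟨ ops-h (x ∘ suc) q (+ 1 ℤ.+ e) k (≡.trans
      (ℤ-solve 2 (λ e s → (⊚ (+ 1) ⊕ e) ⊕ s ⊜ e ⊕ (⊚ (+ 1) ⊕ s)) ≡.refl e (+ (M ℕ.+ q))) eq) ⟩
    0#                                                                 ∎

  det-ψ≈det-Δh : (∀ a → α a * (1# - x a) ≈ 1#) → ∀ {n} q → suc n ≡ M ℕ.+ q → (ν : Fin (suc n) → ℕ) →
    det (suc n) (λ i j → ψ x α (+ toℕ i ℤ.- + toℕ j ℤ.+ ℤ.- (+ 1)) (+ ν i ℤ.- + suc (toℕ i)))
      ≈ det (suc n) (λ i j → Δ^ (toℕ i) (h x) (+ ν i ℤ.+ + toℕ j ℤ.- + toℕ i))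
  det-ψ≈det-Δh inverse {n} q p≡ ν = begin
    L                                                   ≈⟨ *-identityˡ L ⟨
    1# * L                                              ≈⟨ *-congʳ (pow-inverse (suc n) (prodFin-inverse inverse)) ⟨
    pow A (suc n) * pow P (suc n) * L                   ≈⟨ *-assoc _ _ _ ⟩
    pow A (suc n) * (pow P (suc n) * L)                 ≈⟨ *-congˡ scaled ⟩
    pow A (suc n) * (pow P (suc n) * D)                 ≈⟨ *-assoc _ _ _ ⟨
    pow A (suc n) * pow P (suc n) * D                   ≈⟨ *-congʳ (pow-inverse (suc n) (prodFin-inverse inverse)) ⟩
    1# * D                                              ≈⟨ *-identityˡ D ⟩
    D                                                   ∎
    where
    A P L D : Carrier
    A = prodFin M α
    P = prodFin M (λ a → 1# - x a)
    L = det (suc n) (λ i j → ψ x α (+ toℕ i ℤ.- + toℕ j ℤ.+ ℤ.- (+ 1)) (+ ν i ℤ.- + suc (toℕ i)))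
    D = det (suc n) (λ i j → Δ^ (toℕ i) (h x) (+ ν i ℤ.+ + toℕ j ℤ.- + toℕ i))

    E : ℤ → ℤ → Fin (suc n) → Carrier
    E m e i = ψ x α (+ toℕ i ℤ.+ m ℤ.+ ℤ.- (+ 1)) ((+ ν i ℤ.- + suc (toℕ i)) ℤ.+ e)

    E-suc : ∀ m e i → E (+ 1 ℤ.+ m) e i ≈ E m e i - E m (+ 1 ℤ.+ e) i
    E-suc m e i = trans (solve 2 (λ p q → p := q :- (q :- p)) refl _ (E m e i)) (+-congˡ (-‿cong (sym (begin
      ψ x α m′ (ν′ ℤ.+ (+ 1 ℤ.+ e))       ≡⟨ ≡.cong (ψ x α m′) (ℤ-solve 2 (λ n e → n ⊕ (⊚ (+ 1) ⊕ e) ⊜ ⊚ (+ 1) ⊕ (n ⊕ e)) ≡.refl ν′ e) ⟩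
      ψ x α m′ (+ 1 ℤ.+ (ν′ ℤ.+ e))       ≈⟨ ψ-suc x α m′ (ν′ ℤ.+ e) ⟩
      ψ x α m′ (ν′ ℤ.+ e) - ψ x α (+ 1 ℤ.+ m′) (ν′ ℤ.+ e)
        ≡⟨ ≡.cong (λ t → ψ x α m′ (ν′ ℤ.+ e) - ψ x α t (ν′ ℤ.+ e))
             (ℤ-solve 2 (λ i m → ⊚ (+ 1) ⊕ (i ⊕ m ⊕ ⊚ (ℤ.- (+ 1))) ⊜ i ⊕ (⊚ (+ 1) ⊕ m) ⊕ ⊚ (ℤ.- (+ 1))) ≡.refl (+ toℕ i) m) ⟩
      E m e i - E (+ 1 ℤ.+ m) e i         ∎))))
      where
      m′ = + toℕ i ℤ.+ m ℤ.+ ℤ.- (+ 1)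
      ν′ = + ν i ℤ.- + suc (toℕ i)

    E≈0 : ∀ m i → ops (pad x) (suc n) (λ e → E m e i) (+ 0) ≈ 0#
    E≈0 m i = ≡.subst (λ p → ops (pad x) p (λ e → E m e i) (+ 0) ≈ 0#) (≡.sym p≡)
      (trans (ops-translate (pad x) (M ℕ.+ q) ν′ (ψ x α m′) (+ 0))
        (ops-ψ x α inverse q m′ (ν′ ℤ.+ + 0) (ν i ℕ.+ (n ℕ.∸ toℕ i)) nonnegative))
      where
      m′ = + toℕ i ℤ.+ m ℤ.+ ℤ.- (+ 1)
      ν′ = + ν i ℤ.- + suc (toℕ i)
      -- The exponent of u in row i, after adding the degree n + 1, is ν_i + (n - i), and i ≤ n.
      nonnegative : ν′ ℤ.+ + 0 ℤ.+ + (M ℕ.+ q) ≡ + (ν i ℕ.+ (n ℕ.∸ toℕ i))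
      nonnegative = ≡.trans (≡.cong (λ t → ν′ ℤ.+ + 0 ℤ.+ + t) (≡.sym p≡)) (≡.trans
        (ℤ-solve 3 (λ v i n → v ⊖ (⊚ (+ 1) ⊕ i) ⊕ ⊚ (+ 0) ⊕ (⊚ (+ 1) ⊕ n) ⊜ v ⊕ (n ⊖ i)) ≡.refl (+ ν i) (+ toℕ i) (+ n))
        (≡.cong (λ t → + ν i ℤ.+ t) (≡.sym (pos-∸ (ℕₚ.≤-pred (Finₚ.toℕ<n i))))))

    factor≈P : prodℕ (suc n) (λ k → 1# - pad x k) ≈ P
    factor≈P = ≡.subst (λ p → prodℕ p (λ k → 1# - pad x k) ≈ P) (≡.sym p≡) (prodℕ-pad x q)

    entry : ∀ i j → E (+ 1) (+ toℕ j) i ≈ P * Δ^ (toℕ i) (h x) (+ ν i ℤ.+ + toℕ j ℤ.- + toℕ i)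
    entry i j = begin
      E (+ 1) (+ toℕ j) i
        ≡⟨ ≡.cong (λ m → ψ x α m e) (ℤ-solve 1 (λ i → i ⊕ ⊚ (+ 1) ⊕ ⊚ (ℤ.- (+ 1)) ⊜ i) ≡.refl (+ toℕ i)) ⟩
      ψ x α (+ toℕ i) e                                ≈⟨ ψ-Δ^ (toℕ i) e ⟩
      Δ^ (toℕ i) (ψ x α (+ 0)) e                       ≈⟨ Δ^-cong (toℕ i) (ψ≈h x α inverse) e ⟩
      Δ^ (toℕ i) (λ e → P * h x (+ 1 ℤ.+ e)) e         ≈⟨ Δ^-scale-translate (toℕ i) P (h x) e ⟩
      P * Δ^ (toℕ i) (h x) (+ 1 ℤ.+ e)
        ≡⟨ ≡.cong (λ t → P * Δ^ (toℕ i) (h x) t)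
             (ℤ-solve 3 (λ v i j → ⊚ (+ 1) ⊕ (v ⊖ (⊚ (+ 1) ⊕ i) ⊕ j) ⊜ v ⊕ j ⊖ i) ≡.refl (+ ν i) (+ toℕ i) (+ toℕ j)) ⟩
      P * Δ^ (toℕ i) (h x) (+ ν i ℤ.+ + toℕ j ℤ.- + toℕ i) ∎
      where e = (+ ν i ℤ.- + suc (toℕ i)) ℤ.+ + toℕ j

    scaled : pow P (suc n) * L ≈ pow P (suc n) * D
    scaled = begin
      pow P (suc n) * L
        ≈⟨ *-cong (pow-cong (suc n) factor≈P) (det-cong {suc n} λ i j → reflexive (≡.cong (ψ x α (+ toℕ i ℤ.- + toℕ j ℤ.+ ℤ.- (+ 1))) (ℤₚ.+-identityʳ (+ ν i ℤ.- + suc (toℕ i))))) ⟨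
      pow (prodℕ (suc n) (λ k → 1# - pad x k)) (suc n) * det-cols (λ j → E (ℤ.- + j) (+ 0))
        ≈⟨ *-congˡ (trans (det-shear-lower E E-suc) (det-shear-upper E E-suc)) ⟩
      pow (prodℕ (suc n) (λ k → 1# - pad x k)) (suc n) * det-cols (λ j → E (ℤ.- + n) (+ j))
        ≈⟨ det-advance E E-suc (pad x) E≈0 (suc n) (ℤ.- + n) ⟨
      det-cols (λ j → E (+ suc n ℤ.+ ℤ.- + n) (+ j))
        ≡⟨ ≡.cong (λ m → det-cols (λ j → E m (+ j))) (ℤ-solve 1 (λ n → (⊚ (+ 1) ⊕ n) ⊕ (⊝ n) ⊜ ⊚ (+ 1)) ≡.refl (+ n)) ⟩
      det-cols (λ j → E (+ 1) (+ j))                     ≈⟨ det-cong entry ⟩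
      det (suc n) (λ i j → P * Δ^ (toℕ i) (h x) (+ ν i ℤ.+ + toℕ j ℤ.- + toℕ i))
        ≈⟨ det-scale-rows {suc n} (λ _ → P) (λ i j → Δ^ (toℕ i) (h x) (+ ν i ℤ.+ + toℕ j ℤ.- + toℕ i)) ⟩
      prodFin (suc n) (λ _ → P) * D                      ≈⟨ *-congʳ (prodFin-const (suc n) P) ⟩
      pow P (suc n) * D                                  ∎

  -- More rows than variables: the columns satisfy the recurrence of h.
  det-Δh-vanish : ∀ {n} q → n ≡ M ℕ.+ q → (a ν : Fin (suc n) → ℕ) → (∀ i → 0 < ν i) →
    det (suc n) (λ i j → Δ^ (a i) (h x) (+ ν i ℤ.+ + toℕ j ℤ.- + toℕ i)) ≈ 0#
  det-Δh-vanish {n} q n≡ a ν ν>0 = trans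
    (det-cong λ i j → reflexive (≡.cong (Δ^ (a i) (h x)) (ℤ-solve 3 (λ v j i → v ⊕ j ⊖ i ⊜ (v ⊖ i) ⊕ j) ≡.refl (+ ν i) (+ toℕ j) (+ toℕ i))))
    (det-vanish (pad x) (λ i e → Δ^ (a i) (h x) ((+ ν i ℤ.- + toℕ i) ℤ.+ e)) vanish)
    where
    -- A positive part is what keeps the index above 0 even in the last row.
    index : ∀ i j → Σ ℕ λ k → + j ℤ.+ (+ ν i ℤ.- + toℕ i ℤ.+ + 0) ℤ.+ + n ≡ + suc k
    index i j with ν i | ν>0 i
    ... | suc v | _ = j ℕ.+ v ℕ.+ (n ℕ.∸ toℕ i) , ≡.trans
      (ℤ-solve 4 (λ j v i n → j ⊕ ((⊚ (+ 1) ⊕ v) ⊖ i ⊕ ⊚ (+ 0)) ⊕ n ⊜ ⊚ (+ 1) ⊕ (j ⊕ v ⊕ (n ⊖ i))) ≡.refl (+ j) (+ v) (+ toℕ i) (+ n))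
      (≡.cong (λ t → + 1 ℤ.+ (+ (j ℕ.+ v) ℤ.+ t)) (≡.sym (pos-∸ (ℕₚ.≤-pred (Finₚ.toℕ<n i)))))

    vanish : ∀ i → ops (pad x) n (λ e → Δ^ (a i) (h x) ((+ ν i ℤ.- + toℕ i) ℤ.+ e)) (+ 0) ≈ 0#
    vanish i = begin
      ops (pad x) n (λ e → Δ^ (a i) (h x) (d ℤ.+ e)) (+ 0)   ≈⟨ ops-translate (pad x) n d (Δ^ (a i) (h x)) (+ 0) ⟩
      ops (pad x) n (Δ^ (a i) (h x)) (d ℤ.+ + 0)             ≈⟨ ops-Δ^ (pad x) n (a i) (h x) (d ℤ.+ + 0) ⟩
      Δ^ (a i) (ops (pad x) n (h x)) (d ℤ.+ + 0)             ≡⟨ ≡.cong (Δ^ (a i) (ops (pad x) n (h x))) (≡.sym (ℤₚ.+-identityˡ (d ℤ.+ + 0))) ⟩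
      Δ^ (a i) (ops (pad x) n (h x)) (+ 0 ℤ.+ (d ℤ.+ + 0))   ≈⟨ Δ^-zero (a i) (ops (pad x) n (h x)) (d ℤ.+ + 0) base 0 ⟩
      0#                                                     ∎
      where
      d = + ν i ℤ.- + toℕ i
      base : ∀ j → ops (pad x) n (h x) (+ j ℤ.+ (d ℤ.+ + 0)) ≈ 0#
      base j with index i j
      ... | k , eq = ≡.subst (λ p → ops (pad x) p (h x) (+ j ℤ.+ (d ℤ.+ + 0)) ≈ 0#) (≡.sym n≡)
        (ops-h x q (+ j ℤ.+ (d ℤ.+ + 0)) k (≡.trans (≡.cong (λ t → + j ℤ.+ (d ℤ.+ + 0) ℤ.+ + t) (≡.sym n≡)) eq))

  det-ψ≈det-Δh-exponents : (∀ a → α a * (1# - x a) ≈ 1#) → ∀ {n} → 0 < n → M ℕ.≤ n → (a ν : Fin n → ℕ) →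
    (n ≡ M → ∀ i → a i ≡ toℕ i) → (M < n → ∀ i → 0 < ν i) →
    det n (λ i j → ψ x α (+ toℕ i ℤ.- + toℕ j ℤ.+ ℤ.- (+ 1)) (+ ν i ℤ.- + suc (toℕ i)))
      ≈ det n (λ i j → Δ^ (a i) (h x) (+ ν i ℤ.+ + toℕ j ℤ.- + toℕ i))
  det-ψ≈det-Δh-exponents inverse {suc n} _ M≤n a ν a≡ ν>0 with ℕₚ.m≤n⇒m<n∨m≡n M≤n
  ... | inj₂ M≡n = trans (det-ψ≈det-Δh inverse 0 (≡.trans (≡.sym M≡n) (≡.sym (ℕₚ.+-identityʳ M))) ν)
    (det-cong λ i j → reflexive (≡.cong (λ k → Δ^ k (h x) (+ ν i ℤ.+ + toℕ j ℤ.- + toℕ i)) (≡.sym (a≡ (≡.sym M≡n) i))))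
  -- Beyond M rows the orders `a` need not agree with `toℕ`, so the two determinants are not matched
  -- directly: each is zero.
  ... | inj₁ M<n@(s≤s M≤n′) = trans (det-ψ≈det-Δh inverse (suc (n ℕ.∸ M)) (≡.trans (≡.cong suc n≡) (≡.sym (ℕₚ.+-suc M _))) ν)
    (trans (det-Δh-vanish (n ℕ.∸ M) n≡ toℕ ν (ν>0 M<n)) (sym (det-Δh-vanish (n ℕ.∸ M) n≡ a ν (ν>0 M<n))))
    where
    n≡ : n ≡ M ℕ.+ (n ℕ.∸ M)
    n≡ = ≡.sym (ℕₚ.m+[n∸m]≡n M≤n′)

  𝒢mono≈det-ψ : ∀ {n} (I : Fin n → ℤ) →
    𝒢mono x α I ≈ det n (λ i j → ψ x α (+ toℕ i ℤ.- + toℕ j ℤ.+ ℤ.- (+ 1)) (I i ℤ.- + suc (toℕ i)))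
  -- The rewriting turns the factor with exponent - (M - M) into `posF 1# 0`, the last entry of
  -- `denominator`.
  𝒢mono≈det-ψ {n} I rewrite ℤₚ.+-inverseʳ (+ M) =
    Pairing.IR-crossTerm R n λ j → form (ℤ.- (+ 1)) (oneMinusZ^ (I j ℤ.- + suc (toℕ j)) ∷ numerator M ++ denominator x α)

-- The identity for a partition padded with zeros to at least M entries.

nth-positive : ∀ {λs} → All (0 <_) λs → ∀ {k} → k < length λs → 0 < nth λs k
nth-positive (p ∷ _)  {zero}  _         = p
nth-positive (_ ∷ ps) {suc k} (s≤s k<n) = nth-positive ps k<n

open CommutativeRing using (Carrier; _≈_; _*_; _-_; 1#)
open WithRing using (𝒢mono; 𝒮)

theorem2p9 : ∀ {c ℓ} (R : CommutativeRing c ℓ) (M : ℕ) → 0 < M →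
    (x α : Fin M → Carrier R) →
    (∀ i → _≈_ R (_*_ R (α i) (_-_ R (1# R) (x i))) (1# R)) →
    (λs : List ℕ) → IsPartition λs →
    _≈_ R (𝒢mono R x α (padExp M λs)) (𝒮 R x (rhsPoly M λs))
theorem2p9 R M 0<M x α inverse λs (_ , positive) = begin
  𝒢mono R x α (padExp M λs)  ≈⟨ 𝒢mono≈det-ψ (padExp M λs) ⟩
  _                          ≈⟨ det-ψ≈det-Δh-exponents inverse (ℕₚ.<-≤-trans 0<M M≤len) M≤len (bumps M (embed M λs) toℕ) (λ i → nth λs (toℕ i))
                                  exponents parts ⟩
  _                          ≈⟨ SchurSide.𝒮-rhsPoly R x λs ⟨
  𝒮 R x (rhsPoly M λs)       ∎
  where
  open Comparison R x α
  open SchurSide R using (bumps; bumps-at)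
  open import Relation.Binary.Reasoning.Setoid (CommutativeRing.setoid R)

  M≤len : M ℕ.≤ len M λs
  M≤len = ℕₚ.m≤n⊔m (length λs) M

  exponents : len M λs ≡ M → ∀ i → bumps M (embed M λs) toℕ i ≡ toℕ i
  exponents len≡M i = bumps-at M (embed M λs) toℕ 0 (λ r → Finₚ.toℕ-inject≤ r M≤len) (λ _ → ≡.refl) i z≤n
    (ℕₚ.<-≤-trans (Finₚ.toℕ<n i) (ℕₚ.≤-reflexive len≡M))

  -- More than M rows occur only when `λs` is longer than M; then no zeros are appended and every
  -- row has a genuine part.
  parts : M < len M λs → ∀ i → 0 < nth λs (toℕ i)
  parts M<len i with ℕₚ.≤-total M (length λs)
  ... | inj₁ M≤ℓ = nth-positive positive (ℕₚ.<-≤-trans (Finₚ.toℕ<n i) (ℕₚ.≤-reflexive (ℕₚ.m≥n⇒m⊔n≡m M≤ℓ)))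
  ... | inj₂ ℓ≤M = contradiction (ℕₚ.≤-reflexive (ℕₚ.m≤n⇒m⊔n≡n ℓ≤M)) (ℕₚ.<⇒≱ M<len)
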